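{- There is a $3$-tardy c.e. set $A$ such that for all $2$-tardy c.e. sets $B$, $A \nleq_T B$.
   Context: Sets are subsets of $\omega$; $\{W_{e}\}_{e\in\omega}$ is the standard listing of the c.e. sets with standard stagewise enumeration $\{W_{e,s}\}_{s\in\omega}$ (only numbers less than $s$ belong to $W_{e,s}$). $\overline{A}=\omega\setminus A$, and $\le_T$ is Turing reducibility. $n$-c.e. sets: for $n\ge 1$, a set $X$ is $n$-c.e. iff there are c.e. sets $X_1,\dots,X_n$ such that $X=(X_1-X_2)\cup\dots\cup(X_{n-2}-X_{n-1})\cup X_n$ if $n$ is odd, and $X=(X_1-X_2)\cup\dots\cup(X_{n-1}-X_n)$ if $n$ is even. Fix an effective listing of all such presentations (sequences $W_{e_1},\dots,W_{e_n}$ of c.e. sets given by indices); $X^n_e$ denotes the $e$-th $n$-c.e. set in this listing, and $X^n_{e,s}$ denotes its stage-$s$ approximation, obtained by replacing each $W_{e_i}$ by $W_{e_i,s}$ in the formula above. $n$-tardy: let $A$ be c.e. with a computable enumeration $\{A_s\}_{s\in\omega}$. $A$ is $n$-tardy iff for every nondecreasing total computable function $p$ there is an $e$ such that $X^n_e=\overline{A}$ and, for all $x$ and all $s$, $x\in X^n_{e,s}$ implies $x\notin A_{p(s)}$. (This notion does not depend on the choice of enumeration of $A$.) -}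

module Defs where

open import Data.Nat.Base
  using (ℕ; zero; suc; _+_; _≤_; _<_; _%_; ⌊_/2⌋; s≤s)
open import Data.Nat.Properties
  using (+-suc; +-identityʳ; +-comm; suc-injective; ≤-refl; ≤-trans; m≤m+n; m≤n+m)
open import Data.Product.Base using (_×_; _,_; proj₁; proj₂; ∃; ∃-syntax; Σ-syntax)
open import Data.Vec.Base using (Vec; []; _∷_)
open import Level using (0ℓ)
open import Relation.Binary.Definitions using (Monotonic₁)
open import Relation.Binary.PropositionalEquality
  using (_≡_; refl; sym; trans; cong; cong₂)
open import Relation.Unary
  using (Pred; ∅; ∁; _∈_; _∉_; _⊆_; _≐_; _∪_; _∖_; ⋃)

------------------------------------------------------------------------
-- Cantor pairing

triangle : ℕ → ℕ
triangle zero    = 0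
triangle (suc n) = suc n + triangle n

⟨_,_⟩ : ℕ → ℕ → ℕ
⟨ a , b ⟩ = triangle (a + b) + a

-- Walks along the antidiagonals (0,0), (0,1), (1,0), (0,2), (1,1), (2,0), …

next : ℕ × ℕ → ℕ × ℕ
next (a , zero)  = 0 , suc a
next (a , suc b) = suc a , b

unpair : ℕ → ℕ × ℕ
unpair zero    = 0 , 0
unpair (suc n) = next (unpair n)

unpair-⟨⟩ : ∀ a b → unpair ⟨ a , b ⟩ ≡ (a , b)
unpair-⟨⟩ a b = go (a + b) a b refl
  where
  go : ∀ n a b → a + b ≡ n → unpair ⟨ a , b ⟩ ≡ (a , b)
  go n zero zero _ = refl
  go (suc n) zero (suc b) eq =
    trans (cong unpair step)
          (cong next (go n b zero (trans (+-identityʳ b) (suc-injective eq))))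
    where
    step : ⟨ 0 , suc b ⟩ ≡ suc ⟨ b , 0 ⟩
    step = cong suc (trans (+-identityʳ _)
             (trans (+-comm b (triangle b))
                    (cong (λ k → triangle k + b) (sym (+-identityʳ b)))))
  go n (suc a) b eq =
    trans (cong unpair step) (cong next (go n a (suc b) (trans (+-suc a b) eq)))
    where
    step : ⟨ suc a , b ⟩ ≡ suc ⟨ a , suc b ⟩
    step = trans (cong (λ k → triangle k + suc a) (sym (+-suc a b)))
                 (+-suc (triangle (a + suc b)) a)

------------------------------------------------------------------------
-- Oracle programs: Kleene's schemata for partial recursive functions of
-- one argument, several arguments being coded by pairing, together with
-- an instruction querying the characteristic function of the oracle.

data Code : Set where
  zero succ left right oracle : Code
  pair comp prec : Code → Code → Code
  rfind : Code → Code

infix 4 _⊢_∙_⇓_∣_ _⊢_∙_⇓_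

-- B ⊢ c ∙ x ⇓ y ∣ t : with oracle B, the program c halts on input x with
-- output y after exactly t steps.

data _⊢_∙_⇓_∣_ (B : Pred ℕ 0ℓ) : Code → ℕ → ℕ → ℕ → Set where

  zero  : ∀ {x} → B ⊢ zero  ∙ x ⇓ 0 ∣ 1
  succ  : ∀ {x} → B ⊢ succ  ∙ x ⇓ suc x ∣ 1
  left  : ∀ {x} → B ⊢ left  ∙ x ⇓ proj₁ (unpair x) ∣ 1
  right : ∀ {x} → B ⊢ right ∙ x ⇓ proj₂ (unpair x) ∣ 1

  oracle-∈ : ∀ {x} → x ∈ B → B ⊢ oracle ∙ x ⇓ 1 ∣ 1
  oracle-∉ : ∀ {x} → x ∉ B → B ⊢ oracle ∙ x ⇓ 0 ∣ 1

  pair : ∀ {f g x y z s t} →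
         B ⊢ f ∙ x ⇓ y ∣ s →
         B ⊢ g ∙ x ⇓ z ∣ t →
         B ⊢ pair f g ∙ x ⇓ ⟨ y , z ⟩ ∣ suc (s + t)

  comp : ∀ {f g x y z s t} →
         B ⊢ g ∙ x ⇓ y ∣ s →
         B ⊢ f ∙ y ⇓ z ∣ t →
         B ⊢ comp f g ∙ x ⇓ z ∣ suc (s + t)

  -- h ⟨ a , 0 ⟩ = f a  and  h ⟨ a , n + 1 ⟩ = g ⟨ a , ⟨ n , h ⟨ a , n ⟩ ⟩ ⟩

  prec-zero : ∀ {f g x a y t} →
              unpair x ≡ (a , zero) →
              B ⊢ f ∙ a ⇓ y ∣ t →
              B ⊢ prec f g ∙ x ⇓ y ∣ suc t
  prec-suc  : ∀ {f g x a n y z s t} →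
              unpair x ≡ (a , suc n) →
              B ⊢ prec f g ∙ ⟨ a , n ⟩ ⇓ y ∣ s →
              B ⊢ g ∙ ⟨ a , ⟨ n , y ⟩ ⟩ ⇓ z ∣ t →
              B ⊢ prec f g ∙ x ⇓ z ∣ suc (s + t)

  -- On ⟨ a , m ⟩: the least k ≥ m with f ⟨ a , k ⟩ = 0, provided that
  -- f ⟨ a , i ⟩ halts whenever m ≤ i < k.

  rfind-zero : ∀ {f x t} →
               B ⊢ f ∙ x ⇓ zero ∣ t →
               B ⊢ rfind f ∙ x ⇓ proj₂ (unpair x) ∣ suc t
  rfind-suc  : ∀ {f x a m v k s t} →
               unpair x ≡ (a , m) →
               B ⊢ f ∙ x ⇓ suc v ∣ s →
               B ⊢ rfind f ∙ ⟨ a , suc m ⟩ ⇓ k ∣ t →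
               B ⊢ rfind f ∙ x ⇓ k ∣ suc (s + t)

_⊢_∙_⇓_ : Pred ℕ 0ℓ → Code → ℕ → ℕ → Set
B ⊢ c ∙ x ⇓ y = ∃[ t ] B ⊢ c ∙ x ⇓ y ∣ t

------------------------------------------------------------------------
-- Numbering of the programs

-- The first argument is fuel; since both components of unpair m are at
-- most m, any fuel greater than the number being decoded suffices.

decode : ℕ → ℕ → Code
decode zero    _ = zero
decode (suc i) 0 = zero
decode (suc i) 1 = succ
decode (suc i) 2 = left
decode (suc i) 3 = right
decode (suc i) 4 = oracle
decode (suc i) (suc (suc (suc (suc (suc m))))) = node (proj₁ (unpair m)) (proj₂ (unpair m))
  where
  node : ℕ → ℕ → Code
  node 0 r = rfind (decode i r)
  node 1 r = pair (decode i (proj₁ (unpair r))) (decode i (proj₂ (unpair r)))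
  node 2 r = comp (decode i (proj₁ (unpair r))) (decode i (proj₂ (unpair r)))
  node _ r = prec (decode i (proj₁ (unpair r))) (decode i (proj₂ (unpair r)))

program : ℕ → Code
program e = decode (suc e) e

encode : Code → ℕ
encode zero       = 0
encode succ       = 1
encode left       = 2
encode right      = 3
encode oracle     = 4
encode (rfind f)  = 5 + ⟨ 0 , encode f ⟩
encode (pair f g) = 5 + ⟨ 1 , ⟨ encode f , encode g ⟩ ⟩
encode (comp f g) = 5 + ⟨ 2 , ⟨ encode f , encode g ⟩ ⟩
encode (prec f g) = 5 + ⟨ 3 , ⟨ encode f , encode g ⟩ ⟩

private
  n≤triangle : ∀ n → n ≤ triangle n
  n≤triangle zero    = ≤-refl
  n≤triangle (suc n) = m≤m+n (suc n) (triangle n)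

a≤⟨a,b⟩ : ∀ a b → a ≤ ⟨ a , b ⟩
a≤⟨a,b⟩ a b = m≤n+m a (triangle (a + b))

b≤⟨a,b⟩ : ∀ a b → b ≤ ⟨ a , b ⟩
b≤⟨a,b⟩ a b = ≤-trans (m≤n+m b a) (≤-trans (n≤triangle (a + b)) (m≤m+n _ a))

-- Every program occurs in the numbering.

program-encode : ∀ c → program (encode c) ≡ c
program-encode c = go _ c ≤-refl
  where
  below : ∀ {i} k r → 5 + ⟨ k , r ⟩ < suc i → r < i
  below k r (s≤s h) = ≤-trans (s≤s (≤-trans (b≤⟨a,b⟩ k r) (m≤n+m _ 4))) h

  go : ∀ i c → encode c < i → decode i (encode c) ≡ c

  fst : ∀ i k f g → 5 + ⟨ k , ⟨ encode f , encode g ⟩ ⟩ < suc i →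
        decode i (encode f) ≡ f
  fst i k f g h = go i f (≤-trans (s≤s (a≤⟨a,b⟩ (encode f) (encode g))) (below k _ h))

  snd : ∀ i k f g → 5 + ⟨ k , ⟨ encode f , encode g ⟩ ⟩ < suc i →
        decode i (encode g) ≡ g
  snd i k f g h = go i g (≤-trans (s≤s (b≤⟨a,b⟩ (encode f) (encode g))) (below k _ h))

  go (suc i) zero       h = refl
  go (suc i) succ       h = refl
  go (suc i) left       h = refl
  go (suc i) right      h = refl
  go (suc i) oracle     h = refl
  go (suc i) (rfind f)  h
    rewrite unpair-⟨⟩ 0 (encode f) = cong rfind (go i f (below 0 _ h))
  go (suc i) (pair f g) h
    rewrite unpair-⟨⟩ 1 ⟨ encode f , encode g ⟩ | unpair-⟨⟩ (encode f) (encode g)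
    = cong₂ pair (fst i 1 f g h) (snd i 1 f g h)
  go (suc i) (comp f g) h
    rewrite unpair-⟨⟩ 2 ⟨ encode f , encode g ⟩ | unpair-⟨⟩ (encode f) (encode g)
    = cong₂ comp (fst i 2 f g h) (snd i 2 f g h)
  go (suc i) (prec f g) h
    rewrite unpair-⟨⟩ 3 ⟨ encode f , encode g ⟩ | unpair-⟨⟩ (encode f) (encode g)
    = cong₂ prec (fst i 3 f g h) (snd i 3 f g h)

------------------------------------------------------------------------
-- Computable functions and c.e. sets. Unrelativised computation is
-- computation with the empty oracle.

Computable : (ℕ → ℕ) → Set
Computable f = ∃[ e ] ∀ x → ∅ ⊢ program e ∙ x ⇓ f x

W : ℕ → Pred ℕ 0ℓ
W e x = ∃[ y ] ∅ ⊢ program e ∙ x ⇓ y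

W[_,_] : ℕ → ℕ → Pred ℕ 0ℓ
W[ e , s ] x = x < s × ∃[ y ] ∃[ t ] t ≤ s × ∅ ⊢ program e ∙ x ⇓ y ∣ t

CE : Pred ℕ 0ℓ → Set
CE A = ∃[ e ] A ≐ W e

infix 4 _≤T_

_≤T_ : Pred ℕ 0ℓ → Pred ℕ 0ℓ → Set
A ≤T B = ∃[ e ] ∀ x → (x ∈ A → B ⊢ program e ∙ x ⇓ 1)
                    × (x ∉ A → B ⊢ program e ∙ x ⇓ 0)

------------------------------------------------------------------------
-- n-c.e. sets

-- (X₁ - X₂) ∪ (X₃ - X₄) ∪ ⋯, the last term being Xₙ when n is odd

alternating : (ℕ → Pred ℕ 0ℓ) → ∀ {n} → Vec ℕ n → Pred ℕ 0ℓ
alternating V []            = ∅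
alternating V (e ∷ [])      = V e
alternating V (e ∷ e′ ∷ es) = (V e ∖ V e′) ∪ alternating V es

indices : ∀ n → ℕ → Vec ℕ n
indices zero    e = []
indices (suc n) e = proj₁ (unpair e) ∷ indices n (proj₂ (unpair e))

-- Every n-tuple of c.e. indices occurs in the listing.

indices-onto : ∀ {n} (es : Vec ℕ n) → ∃[ e ] indices n e ≡ es
indices-onto []       = 0 , refl
indices-onto (e ∷ es) with indices-onto es
... | k , refl = ⟨ e , k ⟩ ,
  cong (λ p → proj₁ p ∷ indices _ (proj₂ p)) (unpair-⟨⟩ e k)

X : ℕ → ℕ → Pred ℕ 0ℓ
X n e = alternating W (indices n e)

X[_,_,_] : ℕ → ℕ → ℕ → Pred ℕ 0ℓ
X[ n , e , s ] = alternating (λ i → W[ i , s ]) (indices n e)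

------------------------------------------------------------------------
-- Tardiness

-- The finite set with canonical index u: x ∈ D u iff the coefficient of
-- 2 ^ x in the binary expansion of u is 1.

D : ℕ → Pred ℕ 0ℓ
D u zero    = u % 2 ≡ 1
D u (suc x) = D ⌊ u /2⌋ x

record Enumeration (A : Pred ℕ 0ℓ) : Set where
  field
    index      : ℕ → ℕ
    computable : Computable index
    increasing : ∀ s → D (index s) ⊆ D (index (suc s))
    exhausting : (⋃[ s ∶ ℕ ] D (index s)) ≐ A

  stage : ℕ → Pred ℕ 0ℓ
  stage s = D (index s)

TardyVia : ℕ → (A : Pred ℕ 0ℓ) → Enumeration A → Set
TardyVia n A E =
  ∀ (p : ℕ → ℕ) → Computable p → Monotonic₁ _≤_ _≤_ p →
  ∃[ e ] (X n e ≐ ∁ A) × (∀ x s → x ∈ X[ n , e , s ] → x ∉ stage (p s))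
  where open Enumeration E

-- Tardiness does not depend on the choice of enumeration, so it is enough
-- that TardyVia holds for some enumeration of A.

Tardy : ℕ → Pred ℕ 0ℓ → Set
Tardy n A = Σ[ E ∈ Enumeration A ] TardyVia n A E

{-# OPTIONS --safe #-}
module Submission where

-- Let pₖ be the k-th partial computable function, and Vᵏ the 3-c.e. set that is
-- to witness 3-tardiness for pₖ. To a reduction Φ to a set B enumerated by b,
-- and to an index e of a 2-c.e. set, belongs an owner n with infinitely many
-- followers x. A follower starts at a stage s₀ when Φ predicts x ∉ A from B
-- with use u and when every y < u outside B is in the 2-c.e. set with index e
-- and in the one with index e′, a parameter of x. It then leaves the sets Vᵏ for
-- k = n - 1, …, 0 in turn, waiting after each departure for the value of pₖ at
-- that stage. If no y < u has left the set of e by the end, x may enter A;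
-- otherwise it returns to the sets Vᵏ for good. Only one follower of each
-- owner enters A, so the owners do not interact. For total pₖ the set Vᵏ is
-- wrong about finitely many x only: the winners of the owners n ≤ k, and the
-- followers caught at a divergent value of pⱼ for some j < k, which are bounded
-- as x joins Vʲ only when pⱼ is known to converge up to x.
--
-- Suppose that B is 2-tardy and that Φ computes A from B. Let e be the index
-- for the total function that waits, when a follower belonging to b and Φ has
-- left all Vᵏ, for the change of B below u caused by x ∈ A. No follower of the
-- owner n then enters A, as no y < u would have left the set of e in time. So
-- each follower of n, apart from the finitely many waiting for a divergent
-- value, is cancelled because some y < u left the set of e, and such y enter
-- B. The function that waits for this to happen to the followers from
-- some m on is thus total. If e′ is its index, then the follower x ≥ m with
-- parameter e′ provides some y that enters B too early for e′.

open import Defs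
open import Axiom.ExcludedMiddle using (ExcludedMiddle)
open import Data.Empty using (⊥; ⊥-elim)
open import Data.Fin.Base using (Fin; zero; suc)
open import Data.Fin.Patterns using (0F; 1F; 2F; 3F; 4F; 5F; 6F)
open import Data.Nat.Base
open import Data.Nat.DivMod using (m%n<n)
open import Data.Nat.Properties
open import Data.Nat.Tactic.RingSolver using (solve-∀)
open import Data.Product.Base using (_×_; _,_; proj₁; proj₂; ∃; ∃-syntax; Σ-syntax)
open import Data.Sum.Base using (_⊎_; inj₁; inj₂; [_,_]′)
open import Data.Vec.Base using (Vec; []; _∷_; lookup; map)
open import Function.Base using (_∘_; _$_; case_of_)
open import Level using (0ℓ)
open import Relation.Binary.Definitions using (tri<; tri≈; tri>)
open import Relation.Binary.PropositionalEquality
  using (_≡_; refl; sym; trans; cong; cong₂; subst; subst₂; module ≡-Reasoning)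
open import Relation.Nullary.Decidable using (Dec; yes; no; map′; _×-dec_)
open import Relation.Nullary.Negation using (¬_; contradiction)
open import Relation.Unary using (Pred; ∅; ∁; _∈_; _∉_; _⊆_; _≐_; ⋃)

private variable m n : ℕ

-- Pairing and its projections

⟨⟩-next : ∀ a b → ⟨ proj₁ (next (a , b)) , proj₂ (next (a , b)) ⟩ ≡ suc ⟨ a , b ⟩
⟨⟩-next a zero    = cong suc (trans (+-identityʳ _) (trans (+-comm a (triangle a))
  (cong (λ k → triangle k + a) (sym (+-identityʳ a)))))
⟨⟩-next a (suc b) = trans (cong (λ k → triangle k + suc a) (sym (+-suc a b))) (+-suc _ a)

-- Pairing is opaque to keep terms such as ⟨ 3 , x ⟩ from unfolding into
-- sums.
opaque

  lft rgt : ℕ → ℕ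
  lft x = proj₁ (unpair x)
  rgt x = proj₂ (unpair x)

  infixr 7 _∙_

  _∙_ : ℕ → ℕ → ℕ
  a ∙ b = ⟨ a , b ⟩

  ∙≡⟨⟩ : ∀ a b → a ∙ b ≡ ⟨ a , b ⟩
  ∙≡⟨⟩ a b = refl

  lft-∙ : ∀ a b → lft (a ∙ b) ≡ a
  lft-∙ a b = cong proj₁ (unpair-⟨⟩ a b)

  rgt-∙ : ∀ a b → rgt (a ∙ b) ≡ b
  rgt-∙ a b = cong proj₂ (unpair-⟨⟩ a b)

  -- Induction along the walk: by `⟨⟩-next` each call of `next` raises the code by one, so every
  -- number is the code of a pair.
  lft∙rgt : ∀ x → lft x ∙ rgt x ≡ x
  lft∙rgt zero    = refl
  lft∙rgt (suc x) = trans (⟨⟩-next (lft x) (rgt x)) (cong suc (lft∙rgt x))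

  lft-⟨⟩ : ∀ a b → lft ⟨ a , b ⟩ ≡ a
  lft-⟨⟩ = lft-∙

  rgt-⟨⟩ : ∀ a b → rgt ⟨ a , b ⟩ ≡ b
  rgt-⟨⟩ = rgt-∙

  lft-def : ∀ {x} → lft x ≡ proj₁ (unpair x)
  lft-def = refl

  rgt-def : ∀ {x} → rgt x ≡ proj₂ (unpair x)
  rgt-def = refl

  unpair≡⇒ : ∀ {x a b} → unpair x ≡ (a , b) → lft x ≡ a × rgt x ≡ b
  unpair≡⇒ eq = cong proj₁ eq , cong proj₂ eq

  unpair≡⇒⟨⟩ : ∀ {x a b} → unpair x ≡ (a , b) → x ≡ ⟨ a , b ⟩
  unpair≡⇒⟨⟩ {x} eq = trans (sym (lft∙rgt x)) (cong (λ p → ⟨ proj₁ p , proj₂ p ⟩) eq)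

  a≤a∙b : ∀ a b → a ≤ a ∙ b
  a≤a∙b = a≤⟨a,b⟩

  b≤a∙b : ∀ a b → b ≤ a ∙ b
  b≤a∙b = b≤⟨a,b⟩

lft≤ : ∀ x → lft x ≤ x
lft≤ x = subst (lft x ≤_) (lft∙rgt x) (a≤a∙b (lft x) (rgt x))

rgt≤ : ∀ x → rgt x ≤ x
rgt≤ x = subst (rgt x ≤_) (lft∙rgt x) (b≤a∙b (lft x) (rgt x))

-- Computable functions

deterministic : ∀ {P c x y y′ t t′} → P ⊢ c ∙ x ⇓ y ∣ t → P ⊢ c ∙ x ⇓ y′ ∣ t′ → y ≡ y′
deterministic zero  zero  = refl
deterministic succ  succ  = refl
deterministic left  left  = refl
deterministic right right = refl
deterministic (oracle-∈ _) (oracle-∈ _) = refl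
deterministic (oracle-∈ p) (oracle-∉ q) = contradiction p q
deterministic (oracle-∉ p) (oracle-∈ q) = contradiction q p
deterministic (oracle-∉ _) (oracle-∉ _) = refl
deterministic (pair d e) (pair d′ e′) = cong₂ ⟨_,_⟩ (deterministic d d′) (deterministic e e′)
deterministic (comp d e) (comp d′ e′) with refl ← deterministic d d′ = deterministic e e′
deterministic (prec-zero p d) (prec-zero q d′) with refl ← trans (sym p) q = deterministic d d′
deterministic (prec-zero p d) (prec-suc q _ _) with () ← trans (sym p) q
deterministic (prec-suc p _ _) (prec-zero q _) with () ← trans (sym p) q
deterministic (prec-suc p d e) (prec-suc q d′ e′)
  with refl ← trans (sym p) q with refl ← deterministic d d′ = deterministic e e′
deterministic (rfind-zero _) (rfind-zero _) = refl
deterministic (rfind-zero d) (rfind-suc _ d′ _) with () ← deterministic d d′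
deterministic (rfind-suc _ d _) (rfind-zero d′) with () ← deterministic d d′
deterministic (rfind-suc p _ e) (rfind-suc q _ e′) with refl ← trans (sym p) q = deterministic e e′

-- The closing 0 lets every entry, the last one included, be reached by `left` after some calls of
-- `right`.
⌜_⌝ : ∀ {n} → Vec ℕ n → ℕ
⌜ [] ⌝    = 0
⌜ x ∷ v ⌝ = ⟨ x , ⌜ v ⌝ ⟩

-- Since function and program are bundled, every definition by the combinators below carries its own
-- proof of computability.
record Fun (n : ℕ) : Set where
  field
    ⟦_⟧     : Vec ℕ n → ℕ
    code    : Code
    correct : ∀ v → ∅ ⊢ code ∙ ⌜ v ⌝ ⇓ ⟦_⟧ v

open Fun public

infixr 5 _⨾_

pair⇓ : ∀ {P f g x y z} → P ⊢ f ∙ x ⇓ y → P ⊢ g ∙ x ⇓ z → P ⊢ pair f g ∙ x ⇓ ⟨ y , z ⟩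
pair⇓ (_ , d) (_ , e) = _ , pair d e

_⨾_ : ∀ {P f g x y z} → P ⊢ g ∙ x ⇓ y → P ⊢ f ∙ y ⇓ z → P ⊢ comp f g ∙ x ⇓ z
(_ , d) ⨾ (_ , e) = _ , comp d e

left⇓ : ∀ {P} a b → P ⊢ left ∙ ⟨ a , b ⟩ ⇓ a
left⇓ {P} a b = subst (P ⊢ left ∙ ⟨ a , b ⟩ ⇓_) (cong proj₁ (unpair-⟨⟩ a b)) (_ , left)

right⇓ : ∀ {P} a b → P ⊢ right ∙ ⟨ a , b ⟩ ⇓ b
right⇓ {P} a b = subst (P ⊢ right ∙ ⟨ a , b ⟩ ⇓_) (cong proj₂ (unpair-⟨⟩ a b)) (_ , right)

-- The schemata contain no identity; pairing the two projections gives one because pairing is onto.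
identity : Code
identity = pair left right

opaque
  unfolding lft

  lft⇓ : ∀ {P} x → P ⊢ left ∙ x ⇓ lft x
  lft⇓ x = _ , left

  rgt⇓ : ∀ {P} x → P ⊢ right ∙ x ⇓ rgt x
  rgt⇓ x = _ , right

  ∙⇓ : ∀ {P f g x y z} → P ⊢ f ∙ x ⇓ y → P ⊢ g ∙ x ⇓ z → P ⊢ pair f g ∙ x ⇓ y ∙ z
  ∙⇓ = pair⇓

  identity⇓ : ∀ {P} x → P ⊢ identity ∙ x ⇓ x ∣ 3
  identity⇓ {P} x = subst (λ y → P ⊢ identity ∙ x ⇓ y ∣ 3) (lft∙rgt x) (pair left right)

constant : ℕ → Code
constant zero    = zero
constant (suc k) = comp succ (constant k)

-- The exact step count enters the bound on the running time of `leavingAt k`, which has to be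
-- uniform in `k`.
constant⇓ : ∀ {P} k x → P ⊢ constant k ∙ x ⇓ k ∣ suc (k + k)
constant⇓ zero    x = zero
constant⇓ {P} (suc k) x = subst (λ t → P ⊢ constant (suc k) ∙ x ⇓ suc k ∣ suc t)
  (trans (+-comm _ 1) (cong suc (sym (+-suc k k)))) (comp (constant⇓ k x) succ)

var : Fin n → Fun n
var i = record { ⟦_⟧ = λ v → lookup v i ; code = proj i ; correct = proj⇓ i }
  where
  proj : Fin n → Code
  proj zero    = left
  proj (suc i) = comp (proj i) right
  proj⇓ : ∀ (i : Fin n) v → ∅ ⊢ proj i ∙ ⌜ v ⌝ ⇓ lookup v i
  proj⇓ zero    (x ∷ v) = left⇓ x ⌜ v ⌝
  proj⇓ (suc i) (x ∷ v) = right⇓ x ⌜ v ⌝ ⨾ proj⇓ i v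

lit : ℕ → Fun n
lit k = record { ⟦_⟧ = λ _ → k ; code = constant k ; correct = λ v → _ , constant⇓ k ⌜ v ⌝ }

call : Fun m → Vec (Fun n) m → Fun n
call {m} {n} f gs = record
  { ⟦_⟧     = λ v → ⟦ f ⟧ (map (λ g → ⟦ g ⟧ v) gs)
  ; code    = comp (code f) (tuple gs)
  ; correct = λ v → tuple⇓ gs v ⨾ correct f _ }
  where
  tuple : ∀ {m} → Vec (Fun n) m → Code
  tuple []       = zero
  tuple (g ∷ gs) = pair (code g) (tuple gs)
  tuple⇓ : ∀ {m} (gs : Vec (Fun n) m) v → ∅ ⊢ tuple gs ∙ ⌜ v ⌝ ⇓ ⌜ map (λ g → ⟦ g ⟧ v) gs ⌝
  tuple⇓ []       v = _ , zero
  tuple⇓ (g ∷ gs) v = pair⇓ (correct g v) (tuple⇓ gs v)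

_≗by_ : (f : Fun n) {g : Vec ℕ n → ℕ} → (∀ v → ⟦ f ⟧ v ≡ g v) → Fun n
_≗by_ f {g} eq = record
  { ⟦_⟧ = g ; code = code f
  ; correct = λ v → subst (∅ ⊢ code f ∙ ⌜ v ⌝ ⇓_) (eq v) (correct f v) }

sucᶠ lftᶠ rgtᶠ : Fun n → Fun n
sucᶠ f = record
  { ⟦_⟧ = λ v → suc (⟦ f ⟧ v) ; code = comp succ (code f)
  ; correct = λ v → correct f v ⨾ (_ , succ) }
lftᶠ f = record
  { ⟦_⟧ = λ v → lft (⟦ f ⟧ v) ; code = comp left (code f)
  ; correct = λ v → correct f v ⨾ lft⇓ _ }
rgtᶠ f = record
  { ⟦_⟧ = λ v → rgt (⟦ f ⟧ v) ; code = comp right (code f)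
  ; correct = λ v → correct f v ⨾ rgt⇓ _ }

infixr 7 _∙ᶠ_

_∙ᶠ_ : Fun n → Fun n → Fun n
f ∙ᶠ g = record
  { ⟦_⟧ = λ v → ⟦ f ⟧ v ∙ ⟦ g ⟧ v ; code = pair (code f) (code g)
  ; correct = λ v → ∙⇓ (correct f v) (correct g v) }

primrec : {A : Set} → A → (ℕ → A → A) → ℕ → A
primrec z s zero    = z
primrec z s (suc k) = s k (primrec z s k)

recᶠ : Fun n → Fun (2 + n) → Fun n → Fun n
recᶠ z s k = record
  { ⟦_⟧     = λ v → primrec (⟦ z ⟧ v) (λ i r → ⟦ s ⟧ (i ∷ r ∷ v)) (⟦ k ⟧ v)
  ; code    = comp loop (pair identity (code k))
  ; correct = λ v → pair⇓ (_ , identity⇓ ⌜ v ⌝) (correct k v) ⨾ loop⇓ v (⟦ k ⟧ v) }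
  where
  -- `prec` supplies the parameters first, whereas `s` expects the counter and the previous value at
  -- the front of the tuple.
  body = comp (code s) (pair (comp left right) (pair (comp right right) left))
  loop = prec (code z) body
  body⇓ : ∀ v i r → ∅ ⊢ body ∙ ⟨ ⌜ v ⌝ , ⟨ i , r ⟩ ⟩ ⇓ ⟦ s ⟧ (i ∷ r ∷ v)
  body⇓ v i r =
    pair⇓ (right⇓ ⌜ v ⌝ _ ⨾ left⇓ i r) (pair⇓ (right⇓ ⌜ v ⌝ _ ⨾ right⇓ i r) (left⇓ ⌜ v ⌝ _))
    ⨾ correct s (i ∷ r ∷ v)
  loop⇓ : ∀ v k → ∅ ⊢ loop ∙ ⟨ ⌜ v ⌝ , k ⟩ ⇓ primrec (⟦ z ⟧ v) (λ i r → ⟦ s ⟧ (i ∷ r ∷ v)) k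
  loop⇓ v zero    = _ , prec-zero (unpair-⟨⟩ ⌜ v ⌝ 0) (proj₂ (correct z v))
  loop⇓ v (suc k) = _ , prec-suc (unpair-⟨⟩ ⌜ v ⌝ (suc k)) (proj₂ (loop⇓ v k)) (proj₂ (body⇓ v k _))

skip₂ : Fun n → Fun (2 + n)
skip₂ f = record
  { ⟦_⟧ = λ { (_ ∷ _ ∷ v) → ⟦ f ⟧ v } ; code = comp (code f) (comp right right)
  ; correct = λ { (a ∷ b ∷ v) → (right⇓ a _ ⨾ right⇓ b _) ⨾ correct f v } }

skip-2nd : Fun (1 + n) → Fun (2 + n)
skip-2nd f = record
  { ⟦_⟧ = λ { (a ∷ _ ∷ v) → ⟦ f ⟧ (a ∷ v) } ; code = comp (code f) (pair left (comp right right))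
  ; correct = λ { (a ∷ b ∷ v) → pair⇓ (left⇓ a _) (right⇓ a _ ⨾ right⇓ b _) ⨾ correct f (a ∷ v) } }

ifzero : {A : Set} → ℕ → A → A → A
ifzero zero    a b = a
ifzero (suc _) a b = b

ifzeroᶠ : Fun n → Fun n → Fun n → Fun n
ifzeroᶠ c f g = recᶠ f (skip₂ g) c ≗by λ v → go v (⟦ c ⟧ v)
  where
  go : ∀ v k → primrec (⟦ f ⟧ v) (λ _ _ → ⟦ g ⟧ v) k ≡ ifzero k (⟦ f ⟧ v) (⟦ g ⟧ v)
  go v zero    = refl
  go v (suc k) = refl

predᶠ : Fun n → Fun n
predᶠ f = recᶠ (lit 0) (var zero) f ≗by λ v → go (⟦ f ⟧ v)
  where
  go : ∀ k → primrec 0 (λ i _ → i) k ≡ pred k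
  go zero    = refl
  go (suc k) = refl

infixl 6 _∸ᶠ_ _+ᶠ_

_∸ᶠ_ _+ᶠ_ : Fun n → Fun n → Fun n
f ∸ᶠ g = recᶠ f (predᶠ (var (suc zero))) g ≗by λ v → go (⟦ f ⟧ v) (⟦ g ⟧ v)
  where
  go : ∀ a k → primrec a (λ _ r → pred r) k ≡ a ∸ k
  go a zero    = refl
  go a (suc k) = trans (cong pred (go a k)) (pred[m∸n]≡m∸[1+n] a k)
f +ᶠ g = recᶠ g (sucᶠ (var (suc zero))) f ≗by λ v → go (⟦ g ⟧ v) (⟦ f ⟧ v)
  where
  go : ∀ a k → primrec a (λ _ r → suc r) k ≡ k + a
  go a zero    = refl
  go a (suc k) = cong suc (go a k)

halfᶠ parityᶠ : Fun n → Fun n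
-- The recursion rests on ⌊(k+1)/2⌋ = ⌈k/2⌉ = k ∸ ⌊k/2⌋.
halfᶠ f = recᶠ (lit 0) (var zero ∸ᶠ var (suc zero)) f ≗by λ v → go (⟦ f ⟧ v)
  where
  go : ∀ k → primrec 0 _∸_ k ≡ ⌊ k /2⌋
  go zero    = refl
  go (suc k) = trans (cong (k ∸_) (go k))
    (trans (cong (_∸ ⌊ k /2⌋) (sym (⌊n/2⌋+⌈n/2⌉≡n k))) (m+n∸m≡n ⌊ k /2⌋ _))
parityᶠ f = recᶠ (lit 0) (lit 1 ∸ᶠ var (suc zero)) f ≗by λ v → go (⟦ f ⟧ v)
  where
  go : ∀ k → primrec 0 (λ _ r → 1 ∸ r) k ≡ k % 2
  go zero          = refl
  go (suc zero)    = refl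
  go (suc (suc k)) rewrite go k = bit (k % 2) (m%n<n k 2)
    where
    bit : ∀ b → b < 2 → 1 ∸ (1 ∸ b) ≡ b
    bit zero          _ = refl
    bit (suc zero)    _ = refl
    bit (suc (suc _)) (s≤s (s≤s ()))

-- Decidable predicates whose characteristic function is computed by a
-- program, with the value 0 for truth.

record Test (n : ℕ) : Set₁ where
  field
    Holds    : Vec ℕ n → Set
    char     : Fun n
    sound    : ∀ v → ⟦ char ⟧ v ≡ 0 → Holds v
    complete : ∀ v → Holds v → ⟦ char ⟧ v ≡ 0

open Test public

opaque

  holds? : (T : Test n) → ∀ v → Dec (Holds T v)
  holds? T v = map′ (sound T v) (complete T v) (⟦ char T ⟧ v ≟ 0)

infix  4 _≤ᵗ_ _<ᵗ_ _≡ᵗ_ _∈Dᵗ_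
infixr 3 _×ᵗ_
infixr 2 _⊎ᵗ_ _→ᵗ_

_≤ᵗ_ _<ᵗ_ _≡ᵗ_ _∈Dᵗ_ : Fun n → Fun n → Test n
_×ᵗ_ _⊎ᵗ_ _→ᵗ_ : Test n → Test n → Test n
¬ᵗ_ : Test n → Test n

f ≤ᵗ g = record
  { Holds = λ v → ⟦ f ⟧ v ≤ ⟦ g ⟧ v ; char = f ∸ᶠ g
  ; sound = λ v → m∸n≡0⇒m≤n ; complete = λ v → m≤n⇒m∸n≡0 }

f <ᵗ g = sucᶠ f ≤ᵗ g

S ×ᵗ T = record
  { Holds    = λ v → Holds S v × Holds T v
  ; char     = ifzeroᶠ (char S) (char T) (lit 1)
  ; sound    = λ v p → snd v p
  ; complete = λ v p → cmp v p }
  where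
  snd : ∀ v → ifzero (⟦ char S ⟧ v) (⟦ char T ⟧ v) 1 ≡ 0 → Holds S v × Holds T v
  snd v p with ⟦ char S ⟧ v in eq
  ... | zero = sound S v eq , sound T v p
  cmp : ∀ v → Holds S v × Holds T v → ifzero (⟦ char S ⟧ v) (⟦ char T ⟧ v) 1 ≡ 0
  cmp v (p , q) rewrite complete S v p = complete T v q

S ⊎ᵗ T = record
  { Holds    = λ v → Holds S v ⊎ Holds T v
  ; char     = ifzeroᶠ (char S) (lit 0) (char T)
  ; sound    = λ v p → snd v p
  ; complete = λ v p → cmp v p }
  where
  snd : ∀ v → ifzero (⟦ char S ⟧ v) 0 (⟦ char T ⟧ v) ≡ 0 → Holds S v ⊎ Holds T v
  snd v p with ⟦ char S ⟧ v in eq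
  ... | zero  = inj₁ (sound S v eq)
  ... | suc _ = inj₂ (sound T v p)
  cmp : ∀ v → Holds S v ⊎ Holds T v → ifzero (⟦ char S ⟧ v) 0 (⟦ char T ⟧ v) ≡ 0
  cmp v (inj₁ p) rewrite complete S v p = refl
  cmp v (inj₂ q) with ⟦ char S ⟧ v
  ... | zero  = refl
  ... | suc _ = complete T v q

S →ᵗ T = record
  { Holds    = λ v → Holds S v → Holds T v
  ; char     = ifzeroᶠ (char S) (char T) (lit 0)
  ; sound    = λ v p → snd v p
  ; complete = λ v p → cmp v p }
  where
  snd : ∀ v → ifzero (⟦ char S ⟧ v) (⟦ char T ⟧ v) 0 ≡ 0 → Holds S v → Holds T v
  snd v p h rewrite complete S v h = sound T v p
  cmp : ∀ v → (Holds S v → Holds T v) → ifzero (⟦ char S ⟧ v) (⟦ char T ⟧ v) 0 ≡ 0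
  cmp v h with ⟦ char S ⟧ v in eq
  ... | zero  = complete T v (h (sound S v eq))
  ... | suc _ = refl

¬ᵗ S = record
  { Holds    = λ v → ¬ Holds S v
  ; char     = ifzeroᶠ (char S) (lit 1) (lit 0)
  ; sound    = λ v p → snd v p
  ; complete = λ v p → cmp v p }
  where
  snd : ∀ v → ifzero (⟦ char S ⟧ v) 1 0 ≡ 0 → ¬ Holds S v
  snd v p h rewrite complete S v h with () ← p
  cmp : ∀ v → ¬ Holds S v → ifzero (⟦ char S ⟧ v) 1 0 ≡ 0
  cmp v h with ⟦ char S ⟧ v in eq
  ... | zero  = contradiction (sound S v eq) h
  ... | suc _ = refl

f ≡ᵗ g = record
  { Holds    = λ v → ⟦ f ⟧ v ≡ ⟦ g ⟧ v
  ; char     = char T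
  ; sound    = λ v p → ≤-antisym (proj₁ (sound T v p)) (proj₂ (sound T v p))
  ; complete = λ v p → complete T v (≤-reflexive p , ≤-reflexive (sym p)) }
  where T = f ≤ᵗ g ×ᵗ g ≤ᵗ f

f ∈Dᵗ g = record
  { Holds    = λ v → D (⟦ g ⟧ v) (⟦ f ⟧ v)
  ; char     = char T
  ; sound    = λ v p → unshift (⟦ g ⟧ v) (⟦ f ⟧ v) (sound T v p)
  ; complete = λ v p → complete T v (shift (⟦ g ⟧ v) (⟦ f ⟧ v) p) }
  where
  -- Bit `y` of `u` is the parity of `u` halved `y` times. `D` halves first and recurses afterwards,
  -- `recᶠ` halves last; `halved-suc` reconciles the two.
  T = parityᶠ (recᶠ g (halfᶠ (var (suc zero))) f) ≡ᵗ lit 1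
  halved : ℕ → ℕ → ℕ
  halved u y = primrec u (λ _ r → ⌊ r /2⌋) y
  halved-suc : ∀ u y → halved ⌊ u /2⌋ y ≡ halved u (suc y)
  halved-suc u zero    = refl
  halved-suc u (suc y) = cong ⌊_/2⌋ (halved-suc u y)
  shift : ∀ u y → D u y → halved u y % 2 ≡ 1
  shift u zero    p = p
  shift u (suc y) p = subst (λ h → h % 2 ≡ 1) (halved-suc u y) (shift ⌊ u /2⌋ y p)
  unshift : ∀ u y → halved u y % 2 ≡ 1 → D u y
  unshift u zero    p = p
  unshift u (suc y) p = unshift ⌊ u /2⌋ y (subst (λ h → h % 2 ≡ 1) (sym (halved-suc u y)) p)

D? : ∀ u x → Dec (D u x)
D? u x = holds? (lit x ∈Dᵗ lit u) []

callᵗ : Test m → Vec (Fun n) m → Test n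
callᵗ T fs = record
  { Holds    = λ v → Holds T (map (λ f → ⟦ f ⟧ v) fs)
  ; char     = call (char T) fs
  ; sound    = λ v → sound T _
  ; complete = λ v → complete T _ }

-- The bound variable becomes variable 0, so the outer variables shift up by one inside `T`.
∀<ᵗ ∃<ᵗ : Fun n → Test (1 + n) → Test n

∀<ᵗ f T = record
  { Holds    = λ v → ∀ {i} → i < ⟦ f ⟧ v → Holds T (i ∷ v)
  ; char     = recᶠ (lit 0) (ifzeroᶠ (var (suc zero)) (skip-2nd (char T)) (lit 1)) f
  ; sound    = λ v p → snd v (⟦ f ⟧ v) p
  ; complete = λ v p → cmp v (⟦ f ⟧ v) p }
  where
  all : Vec ℕ _ → ℕ → ℕ
  all v = primrec 0 (λ i r → ifzero r (⟦ char T ⟧ (i ∷ v)) 1)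
  snd : ∀ v k → all v k ≡ 0 → ∀ {i} → i < k → Holds T (i ∷ v)
  snd v (suc k) p i<1+k with all v k in eq
  ... | zero with m<1+n⇒m<n∨m≡n i<1+k
  ...   | inj₁ i<k  = snd v k eq i<k
  ...   | inj₂ refl = sound T _ p
  cmp : ∀ v k → (∀ {i} → i < k → Holds T (i ∷ v)) → all v k ≡ 0
  cmp v zero    h = refl
  cmp v (suc k) h rewrite cmp v k (λ i<k → h (m<n⇒m<1+n i<k)) = complete T _ (h ≤-refl)

∃<ᵗ f T = record
  { Holds    = λ v → ∃[ i ] i < ⟦ f ⟧ v × Holds T (i ∷ v)
  ; char     = recᶠ (lit 1) (ifzeroᶠ (var (suc zero)) (lit 0) (skip-2nd (char T))) f
  ; sound    = λ v p → snd v (⟦ f ⟧ v) p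
  ; complete = λ { v (i , i<k , h) → cmp v (⟦ f ⟧ v) i<k h } }
  where
  any : Vec ℕ _ → ℕ → ℕ
  any v = primrec 1 (λ i r → ifzero r 0 (⟦ char T ⟧ (i ∷ v)))
  snd : ∀ v k → any v k ≡ 0 → ∃[ i ] i < k × Holds T (i ∷ v)
  snd v (suc k) p with any v k in eq
  ... | zero  = let i , i<k , h = snd v k eq in i , m<n⇒m<1+n i<k , h
  ... | suc _ = k , ≤-refl , sound T _ p
  cmp : ∀ v k {i} → i < k → Holds T (i ∷ v) → any v k ≡ 0
  cmp v (suc k) i<1+k h with m<1+n⇒m<n∨m≡n i<1+k
  ... | inj₁ i<k rewrite cmp v k i<k h = refl
  ... | inj₂ refl with any v k
  ...   | zero  = refl
  ...   | suc _ = complete T _ h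

-- Characteristic functions are hidden from the conversion checker, which
-- otherwise normalises the universal machine.
opaque

  hidden : Fun n → Fun n
  hidden f = f

  hidden-≡ : (f : Fun n) → ∀ v → ⟦ hidden f ⟧ v ≡ ⟦ f ⟧ v
  hidden-≡ f v = refl

sealed : Test n → Test n
sealed T = record
  { Holds    = Holds T
  ; char     = hidden (char T)
  ; sound    = λ v p → sound T v (trans (sym (hidden-≡ (char T) v)) p)
  ; complete = λ v h → trans (hidden-≡ (char T) v) (complete T v h) }

ifᵗ : Test n → Fun n → Fun n → Fun n
ifᵗ T f g = ifzeroᶠ (char T) f g

module _ (T : Test n) {v : Vec ℕ n} {A : Set} {a b : A} where

  ifᵗ-true : Holds T v → ifzero (⟦ char T ⟧ v) a b ≡ a
  ifᵗ-true h rewrite complete T v h = refl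

  ifᵗ-false : ¬ Holds T v → ifzero (⟦ char T ⟧ v) a b ≡ b
  ifᵗ-false h with ⟦ char T ⟧ v in eq
  ... | zero  = contradiction (sound T v eq) h
  ... | suc _ = refl

-- Unbounded search

Least : (ℕ → Set) → ℕ → Set
Least P k = P k × (∀ {j} → P j → k ≤ j)

least : ∀ {P : ℕ → Set} → (∀ i → Dec (P i)) → ∀ {k} → P k → ∃ (Least P)
least {P} P? {k} pk = go k 0 (subst P (sym (+-identityʳ k)) pk) (λ _ → z≤n)
  where
  -- `d + i` is always the known solution, so `d` bounds the search that remains.
  go : ∀ d i → P (d + i) → (∀ {j} → P j → i ≤ j) → ∃ (Least P)
  go zero    i p below = i , p , below
  go (suc d) i p below with P? i
  ... | yes q = i , q , below
  ... | no ¬q = go d (suc i) (subst P (sym (+-suc d i)) p)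
                   λ r → ≤∧≢⇒< (below r) λ { refl → ¬q r }

module _ (T : Test (1 + n)) where

  private
    body : Code
    -- `rfind` varies the second component of its input, whereas the test has the searched variable
    -- in front.
    body = comp (code (char T)) (pair right left)

    body⇓ : ∀ v s → ∅ ⊢ body ∙ ⟨ ⌜ v ⌝ , s ⟩ ⇓ ⟦ char T ⟧ (s ∷ v)
    body⇓ v s = pair⇓ (right⇓ ⌜ v ⌝ s) (left⇓ ⌜ v ⌝ s) ⨾ correct (char T) (s ∷ v)

    body≡ : ∀ v s {y t} → ∅ ⊢ body ∙ ⟨ ⌜ v ⌝ , s ⟩ ⇓ y ∣ t → y ≡ ⟦ char T ⟧ (s ∷ v)
    body≡ v s d = deterministic d (proj₂ (body⇓ v s))

  search : Code
  search = comp (rfind body) (pair identity zero)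

  search-complete : ∀ v {s} → Least (λ s → Holds T (s ∷ v)) s → ∅ ⊢ search ∙ ⌜ v ⌝ ⇓ s
  search-complete v {s} (h , below) =
    pair⇓ (_ , identity⇓ ⌜ v ⌝) (_ , zero) ⨾ go s 0 (+-identityʳ s)
    where
    go : ∀ d m → d + m ≡ s → ∅ ⊢ rfind body ∙ ⟨ ⌜ v ⌝ , m ⟩ ⇓ s
    go zero m refl = subst (∅ ⊢ rfind body ∙ ⟨ ⌜ v ⌝ , m ⟩ ⇓_) (cong proj₂ (unpair-⟨⟩ ⌜ v ⌝ m))
      (_ , rfind-zero (proj₂ (subst (∅ ⊢ body ∙ ⟨ ⌜ v ⌝ , m ⟩ ⇓_) (complete T _ h) (body⇓ v m))))
    go (suc d) m eq with ⟦ char T ⟧ (m ∷ v) in eq′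
    ... | zero  = contradiction (below (sound T _ eq′)) (<⇒≱ (subst (m <_) eq (s≤s (m≤n+m m d))))
    ... | suc c = _ , rfind-suc (unpair-⟨⟩ ⌜ v ⌝ m)
      (proj₂ (subst (∅ ⊢ body ∙ ⟨ ⌜ v ⌝ , m ⟩ ⇓_) eq′ (body⇓ v m)))
      (proj₂ (go d (suc m) (trans (+-suc d m) eq)))

  search-halts : ∀ v {s} → Holds T (s ∷ v) → ∃[ y ] ∅ ⊢ search ∙ ⌜ v ⌝ ⇓ y
  search-halts v h = let s , l = least (λ s → holds? T (s ∷ v)) h in s , search-complete v l

  -- A halting `rfind` ends with a call of `body` that returns 0, and the argument of this call is
  -- the witness.
  search-sound : ∀ v {y t} → ∅ ⊢ search ∙ ⌜ v ⌝ ⇓ y ∣ t → ∃[ s ] Holds T (s ∷ v)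
  search-sound v (comp d e) with refl ← deterministic d (pair (identity⇓ ⌜ v ⌝) zero) =
    go e (unpair-⟨⟩ ⌜ v ⌝ 0)
    where
    go : ∀ {z k m t} → ∅ ⊢ rfind body ∙ z ⇓ k ∣ t → unpair z ≡ (⌜ v ⌝ , m) → ∃[ s ] Holds T (s ∷ v)
    go {z} {m = m} (rfind-zero d) eq with refl ← unpair≡⇒⟨⟩ {z} eq =
      m , sound T _ (sym (body≡ v m d))
    go (rfind-suc p d e) eq with refl ← trans (sym p) eq = go e (unpair-⟨⟩ ⌜ v ⌝ _)

  opaque

    μ : (∀ v → ∃[ s ] Holds T (s ∷ v)) → ∀ v → ∃ (Least (λ s → Holds T (s ∷ v)))
    μ total v = least (λ s → holds? T (s ∷ v)) (proj₂ (total v))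

  minimise : (∀ v → ∃[ s ] Holds T (s ∷ v)) → Fun n
  minimise total = record
    { ⟦_⟧ = λ v → proj₁ (μ total v) ; code = search
    ; correct = λ v → search-complete v (proj₂ (μ total v)) }

  minimise-least : ∀ total v → Least (λ s → Holds T (s ∷ v)) (⟦ minimise total ⟧ v)
  minimise-least total v = proj₂ (μ total v)

-- Indices of computable functions and of c.e. sets

-- The numbering is opaque since normalising the pairs in a concrete code is
-- not feasible.

-- Several numbers may decode to the same program. The universal machine is verified on the numbers
-- `encode c`, so given indices are first replaced by canonical ones.
Canonical : ℕ → Set
Canonical e = encode (program e) ≡ e

opaque

  number : Code → ℕ
  number = encode

  program-number : ∀ c → program (number c) ≡ c
  program-number = program-encode

  number-canonical : ∀ c → Canonical (number c)
  number-canonical c = cong encode (program-encode c)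

computable⇒ : ∀ {f} → Computable f → Fun 1
computable⇒ {f} (e , p) = record
  { ⟦_⟧ = λ { (x ∷ []) → f x } ; code = comp (program e) left
  ; correct = λ { (x ∷ []) → left⇓ x 0 ⨾ p x } }

unary : Code → Code
unary c = comp c (pair identity zero)

unary⇓ : ∀ {c x y} → ∅ ⊢ c ∙ ⌜ x ∷ [] ⌝ ⇓ y → ∅ ⊢ program (number (unary c)) ∙ x ⇓ y
unary⇓ {c} {x} {y} d = subst (λ c → ∅ ⊢ c ∙ x ⇓ y) (sym (program-number (unary c)))
  (pair⇓ (_ , identity⇓ x) (_ , zero) ⨾ d)

unary⇓⁻ : ∀ {c x y} → ∅ ⊢ program (number (unary c)) ∙ x ⇓ y → ∅ ⊢ c ∙ ⌜ x ∷ [] ⌝ ⇓ y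
unary⇓⁻ {c} {x} {y} d with subst (λ c → ∅ ⊢ c ∙ x ⇓ y) (program-number (unary c)) d
... | _ , comp {y = z} d e = _ , subst (λ z → ∅ ⊢ c ∙ z ⇓ y ∣ _) (deterministic d (pair (identity⇓ x) zero)) e

⇒computable : (f : Fun 1) → Computable (λ x → ⟦ f ⟧ (x ∷ []))
⇒computable f = number (unary (code f)) , λ x → unary⇓ (correct f (x ∷ []))

W-index : Test 2 → ℕ
W-index T = number (unary (search T))

W-index-complete : (T : Test 2) → ∀ {x s} → Holds T (s ∷ x ∷ []) → W (W-index T) x
W-index-complete T {x} h = let y , d = search-halts T (x ∷ []) h in y , unary⇓ d

W-index-sound : (T : Test 2) → ∀ {x} → W (W-index T) x → ∃[ s ] Holds T (s ∷ x ∷ [])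
W-index-sound T {x} (y , d) = search-sound T (x ∷ []) (proj₂ (unary⇓⁻ {search T} d))

-- The use of an oracle computation

-- A strict upper bound on the queries. Adding instead of taking maxima lets
-- the machine below accumulate it in a register.
use : ∀ {P c x y t} → P ⊢ c ∙ x ⇓ y ∣ t → ℕ
use zero  = 0
use succ  = 0
use left  = 0
use right = 0
use (oracle-∈ {x} _)  = suc x
use (oracle-∉ {x} _)  = suc x
use (pair d e)        = use d + use e
use (comp d e)        = use d + use e
use (prec-zero _ d)   = use d
use (prec-suc _ d e)  = use d + use e
use (rfind-zero d)    = use d
use (rfind-suc _ d e) = use d + use e

-- With both implications at hand, positive and negative oracle answers transfer directly.
AgreeBelow : ℕ → Pred ℕ 0ℓ → Pred ℕ 0ℓ → Set
AgreeBelow u P Q = ∀ {z} → z < u → (z ∈ P → z ∈ Q) × (z ∉ P → z ∉ Q)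

use-principle : ∀ {P Q c x y t} (d : P ⊢ c ∙ x ⇓ y ∣ t) → AgreeBelow (use d) P Q → Q ⊢ c ∙ x ⇓ y ∣ t
use-principle zero  _ = zero
use-principle succ  _ = succ
use-principle left  _ = left
use-principle right _ = right
use-principle (oracle-∈ p) a = oracle-∈ (proj₁ (a ≤-refl) p)
use-principle (oracle-∉ p) a = oracle-∉ (proj₂ (a ≤-refl) p)
use-principle (pair d e) a =
  pair (use-principle d λ z< → a (m≤n⇒m≤n+o _ z<)) (use-principle e λ z< → a (m≤n⇒m≤o+n _ z<))
use-principle (comp d e) a =
  comp (use-principle d λ z< → a (m≤n⇒m≤n+o _ z<)) (use-principle e λ z< → a (m≤n⇒m≤o+n _ z<))
use-principle (prec-zero p d) a = prec-zero p (use-principle d a)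
use-principle (prec-suc p d e) a =
  prec-suc p (use-principle d λ z< → a (m≤n⇒m≤n+o _ z<)) (use-principle e λ z< → a (m≤n⇒m≤o+n _ z<))
use-principle (rfind-zero d) a = rfind-zero (use-principle d a)
use-principle (rfind-suc p d e) a =
  rfind-suc p (use-principle d λ z< → a (m≤n⇒m≤n+o _ z<)) (use-principle e λ z< → a (m≤n⇒m≤o+n _ z<))

-- The transferred computation asks the same queries. Hence the use found with oracle `B` is also
-- the one that the machine reports with a finite approximation of `B`.
use-use-principle : ∀ {P Q c x y t} (d : P ⊢ c ∙ x ⇓ y ∣ t) (a : AgreeBelow (use d) P Q) →
                    use (use-principle d a) ≡ use d
use-use-principle zero  _ = refl
use-use-principle succ  _ = refl
use-use-principle left  _ = refl
use-use-principle right _ = refl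
use-use-principle (oracle-∈ p) _ = refl
use-use-principle (oracle-∉ p) _ = refl
use-use-principle (pair d e)       a = cong₂ _+_ (use-use-principle d _) (use-use-principle e _)
use-use-principle (comp d e)       a = cong₂ _+_ (use-use-principle d _) (use-use-principle e _)
use-use-principle (prec-zero _ d)  a = use-use-principle d a
use-use-principle (prec-suc _ d e) a = cong₂ _+_ (use-use-principle d _) (use-use-principle e _)
use-use-principle (rfind-zero d)   a = use-use-principle d a
use-use-principle (rfind-suc _ d e) a = cong₂ _+_ (use-use-principle d _) (use-use-principle e _)

-- A universal machine. A state consists of a control word, a stack of
-- frames, the number of programs started so far and the sum of the uses
-- of the queries made so far. The control word is either a program still
-- to be run on an input, or a value to be returned to the top frame.

config : ℕ → ℕ → ℕ → ℕ → ℕ → ℕ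
config c x K t u = (t ∙ u) ∙ K ∙ c ∙ x

-- Control word 0 is reserved for returns, hence the shift of program numbers by one.
eval : ℕ → ℕ → ℕ → ℕ → ℕ → ℕ
eval c = config (suc c)

return : ℕ → ℕ → ℕ → ℕ → ℕ
return = config 0

-- The number 0 is the empty stack. Tags 0 to 4 mark a pending `rfind`, the first half of a `pair`,
-- a `comp`, a `prec` and the second half of a `pair`.
push : ℕ → ℕ → ℕ → ℕ
push tag d K = suc (tag ∙ d ∙ K)

private

  configᶠ : Fun n → Fun n → Fun n → Fun n → Fun n → Fun n
  configᶠ c x K t u = (t ∙ᶠ u) ∙ᶠ K ∙ᶠ c ∙ᶠ x

  evalᶠ : Fun n → Fun n → Fun n → Fun n → Fun n → Fun n
  evalᶠ c = configᶠ (sucᶠ c)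

  returnᶠ : Fun n → Fun n → Fun n → Fun n → Fun n
  returnᶠ = configᶠ (lit 0)

  pushᶠ : ℕ → Fun n → Fun n → Fun n
  pushᶠ tag d K = sucᶠ (lit tag ∙ᶠ d ∙ᶠ K)

  -- The arguments of the next three functions are c, the two halves of
  -- the number c - 5, x, K, t and u; the arguments w, c, x, K, t and u;
  -- and y, the tag, the data and the rest K of the stack, t and u.

  nodeStep : Fun 7
  nodeStep =
    ifᵗ (tag ≡ᵗ lit 0) (evalᶠ r x (pushᶠ 0 (c ∙ᶠ x) K) t u) (
    ifᵗ (tag ≡ᵗ lit 1) (evalᶠ (lftᶠ r) x (pushᶠ 1 (rgtᶠ r ∙ᶠ x) K) t u) (
    ifᵗ (tag ≡ᵗ lit 2) (evalᶠ (rgtᶠ r) x (pushᶠ 2 (lftᶠ r) K) t u) (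
    ifᵗ (rgtᶠ x ≡ᵗ lit 0) (evalᶠ (lftᶠ r) (lftᶠ x) K t u)
      (evalᶠ c prev (pushᶠ 3 (rgtᶠ r ∙ᶠ prev) K) t u))))
    where
    c = var 0F
    tag = var 1F
    r = var 2F
    x = var 3F
    K = var 4F
    t = var 5F
    u = var 6F
    prev = lftᶠ x ∙ᶠ predᶠ (rgtᶠ x)

  evalStep : Fun 6
  evalStep =
    ifᵗ (c ≡ᵗ lit 0) (returnᶠ (lit 0) K t u) (
    ifᵗ (c ≡ᵗ lit 1) (returnᶠ (sucᶠ x) K t u) (
    ifᵗ (c ≡ᵗ lit 2) (returnᶠ (lftᶠ x) K t u) (
    ifᵗ (c ≡ᵗ lit 3) (returnᶠ (rgtᶠ x) K t u) (
    ifᵗ (c ≡ᵗ lit 4) (returnᶠ (ifᵗ (x ∈Dᵗ w) (lit 1) (lit 0)) K t (u +ᶠ sucᶠ x))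
      (call nodeStep (c ∷ lftᶠ (c ∸ᶠ lit 5) ∷ rgtᶠ (c ∸ᶠ lit 5) ∷ x ∷ K ∷ t ∷ u ∷ []))))))
    where
    w = var 0F
    c = var 1F
    x = var 2F
    K = var 3F
    -- One program is started per rule of a derivation, so this counter ends as the step count of
    -- the derivation.
    t = sucᶠ (var 4F)
    u = var 5F

  returnStep : Fun 6
  returnStep =
    ifᵗ (tag ≡ᵗ lit 0)
      (ifᵗ (y ≡ᵗ lit 0) (returnᶠ (rgtᶠ (rgtᶠ d)) K t u)
        (evalᶠ (lftᶠ d) (lftᶠ (rgtᶠ d) ∙ᶠ sucᶠ (rgtᶠ (rgtᶠ d))) K t u)) (
    ifᵗ (tag ≡ᵗ lit 1) (evalᶠ (lftᶠ d) (rgtᶠ d) (pushᶠ 4 y K) t u) (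
    ifᵗ (tag ≡ᵗ lit 2) (evalᶠ d y K t u) (
    ifᵗ (tag ≡ᵗ lit 3) (evalᶠ (lftᶠ d) (lftᶠ (rgtᶠ d) ∙ᶠ rgtᶠ (rgtᶠ d) ∙ᶠ y) K t u)
      (returnᶠ (d ∙ᶠ y) K t u))))
    where
    y = var 0F
    tag = var 1F
    d = var 2F
    K = var 3F
    t = var 4F
    u = var 5F

  stepᶠ : Fun 2
  stepᶠ =
    ifᵗ (c ≡ᵗ lit 0)
      (ifᵗ (K ≡ᵗ lit 0) σ
        (call returnStep
          (x ∷ lftᶠ (predᶠ K) ∷ lftᶠ (rgtᶠ (predᶠ K)) ∷ rgtᶠ (rgtᶠ (predᶠ K)) ∷ t ∷ u ∷ [])))
      (call evalStep (var 0F ∷ predᶠ c ∷ x ∷ K ∷ t ∷ u ∷ []))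
    where
    σ = var 1F
    t = lftᶠ (lftᶠ σ)
    u = rgtᶠ (lftᶠ σ)
    K = lftᶠ (rgtᶠ σ)
    c = lftᶠ (rgtᶠ (rgtᶠ σ))
    x = rgtᶠ (rgtᶠ (rgtᶠ σ))

opaque

  step : ℕ → ℕ → ℕ
  step w σ = ⟦ stepᶠ ⟧ (w ∷ σ ∷ [])

private
  module _ {w K t u : ℕ} where

   opaque
    unfolding step

    step-eval : ∀ c {x} → step w (eval c x K t u) ≡ ⟦ evalStep ⟧ (w ∷ c ∷ x ∷ K ∷ t ∷ u ∷ [])
    step-eval c {x}
      rewrite lft-∙ (t ∙ u) (K ∙ suc c ∙ x) | rgt-∙ (t ∙ u) (K ∙ suc c ∙ x) | lft-∙ t u | rgt-∙ t u
      | lft-∙ K (suc c ∙ x) | rgt-∙ K (suc c ∙ x) | lft-∙ (suc c) x | rgt-∙ (suc c) x = refl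

    step-halted : ∀ {y} → step w (return y 0 t u) ≡ return y 0 t u
    step-halted {y}
      rewrite rgt-∙ (t ∙ u) (0 ∙ 0 ∙ y) | lft-∙ 0 (0 ∙ y) | rgt-∙ 0 (0 ∙ y) | lft-∙ 0 y = refl

    step-return : ∀ tag d {y} →
      step w (return y (push tag d K) t u) ≡ ⟦ returnStep ⟧ (y ∷ tag ∷ d ∷ K ∷ t ∷ u ∷ [])
    step-return tag d {y}
      rewrite rgt-∙ (t ∙ u) (push tag d K ∙ 0 ∙ y) | lft-∙ (t ∙ u) (push tag d K ∙ 0 ∙ y)
      | lft-∙ t u | rgt-∙ t u | lft-∙ (push tag d K) (0 ∙ y) | rgt-∙ (push tag d K) (0 ∙ y)
      | lft-∙ 0 y | rgt-∙ 0 y | lft-∙ tag (d ∙ K) | rgt-∙ tag (d ∙ K) | lft-∙ d K | rgt-∙ d K = refl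

   step-node : ∀ {c₀ tag r} x → lft c₀ ≡ tag → rgt c₀ ≡ r →
     step w (eval (5 + c₀) x K t u) ≡ ⟦ nodeStep ⟧ (5 + c₀ ∷ tag ∷ r ∷ x ∷ K ∷ suc t ∷ u ∷ [])
   step-node {c₀} x refl refl = step-eval (5 + c₀)

   node-prec-zero : ∀ {c r x a} → lft x ≡ a → rgt x ≡ 0 →
     ⟦ nodeStep ⟧ (c ∷ 3 ∷ r ∷ x ∷ K ∷ t ∷ u ∷ []) ≡ eval (lft r) a K t u
   node-prec-zero lx rx rewrite lx | rx = refl

   node-prec-suc : ∀ {c r x a n} → lft x ≡ a → rgt x ≡ suc n →
     ⟦ nodeStep ⟧ (c ∷ 3 ∷ r ∷ x ∷ K ∷ t ∷ u ∷ []) ≡ eval c (a ∙ n) (push 3 (rgt r ∙ a ∙ n) K) t u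
   node-prec-suc lx rx rewrite lx | rx = refl

  module _ {w K t u x : ℕ} where

    step-zero : step w (eval 0 x K t u) ≡ return 0 K (suc t) u
    step-zero = step-eval 0
    step-succ : step w (eval 1 x K t u) ≡ return (suc x) K (suc t) u
    step-succ = step-eval 1
    step-left : step w (eval 2 x K t u) ≡ return (lft x) K (suc t) u
    step-left = step-eval 2
    step-right : step w (eval 3 x K t u) ≡ return (rgt x) K (suc t) u
    step-right = step-eval 3

    step-oracle-∈ : D w x → step w (eval 4 x K t u) ≡ return 1 K (suc t) (u + suc x)
    step-oracle-∈ p = trans (step-eval 4) (cong (λ y → return y K (suc t) (u + suc x))
      (ifᵗ-true (var 2F ∈Dᵗ var 0F) {v = w ∷ 4 ∷ x ∷ K ∷ t ∷ u ∷ []} p))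
    step-oracle-∉ : ¬ D w x → step w (eval 4 x K t u) ≡ return 0 K (suc t) (u + suc x)
    step-oracle-∉ p = trans (step-eval 4) (cong (λ y → return y K (suc t) (u + suc x))
      (ifᵗ-false (var 2F ∈Dᵗ var 0F) {v = w ∷ 4 ∷ x ∷ K ∷ t ∷ u ∷ []} p))

    step-rfind : ∀ f → let c = encode (rfind f) in
      step w (eval c x K t u) ≡ eval (encode f) x (push 0 (c ∙ x) K) (suc t) u
    step-rfind f = step-node {c₀ = ⟨ 0 , encode f ⟩} x (lft-⟨⟩ 0 (encode f)) (rgt-⟨⟩ 0 (encode f))

    module _ (f g : Code) where

      private
        binary : ℕ → ℕ
        binary k = ⟨ k , ⟨ encode f , encode g ⟩ ⟩

        step-binary : ∀ k → step w (eval (5 + binary k) x K t u) ≡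
          ⟦ nodeStep ⟧ (5 + binary k ∷ k ∷ encode f ∙ encode g ∷ x ∷ K ∷ suc t ∷ u ∷ [])
        step-binary k = step-node {c₀ = binary k} x (lft-⟨⟩ k _)
          (trans (rgt-⟨⟩ k _) (sym (∙≡⟨⟩ (encode f) (encode g))))

      step-pair : step w (eval (encode (pair f g)) x K t u) ≡
                  eval (encode f) x (push 1 (encode g ∙ x) K) (suc t) u
      step-pair = trans (step-binary 1) (cong₂ (λ f g → eval f x (push 1 (g ∙ x) K) (suc t) u)
        (lft-∙ (encode f) (encode g)) (rgt-∙ (encode f) (encode g)))

      step-comp : step w (eval (encode (comp f g)) x K t u) ≡
                  eval (encode g) x (push 2 (encode f) K) (suc t) u
      step-comp = trans (step-binary 2) (cong₂ (λ f g → eval g x (push 2 f K) (suc t) u)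
        (lft-∙ (encode f) (encode g)) (rgt-∙ (encode f) (encode g)))

      step-prec-zero : ∀ {a} → unpair x ≡ (a , 0) →
        step w (eval (encode (prec f g)) x K t u) ≡ eval (encode f) a K (suc t) u
      step-prec-zero eq with lx , rx ← unpair≡⇒ {x} eq = trans (step-binary 3)
        (trans (node-prec-zero {w} lx rx) (cong (λ f → eval f _ K (suc t) u) (lft-∙ (encode f) (encode g))))

      step-prec-suc : ∀ {a n} → unpair x ≡ (a , suc n) →
        step w (eval (encode (prec f g)) x K t u) ≡
        eval (encode (prec f g)) ⟨ a , n ⟩ (push 3 (encode g ∙ a ∙ n) K) (suc t) u
      step-prec-suc {a} {n} eq with lx , rx ← unpair≡⇒ {x} eq = trans (step-binary 3)
        (trans (node-prec-suc {w} lx rx) (cong₂ (λ g p → eval (5 + binary 3) p (push 3 (g ∙ a ∙ n) K) (suc t) u)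
          (rgt-∙ (encode f) (encode g)) (∙≡⟨⟩ a n)))

  module _ {w K t u : ℕ} where

    return-rfind-zero : ∀ c x → step w (return 0 (push 0 (c ∙ x) K) t u) ≡ return (rgt x) K t u
    return-rfind-zero c x = trans (step-return 0 (c ∙ x)) (cong (λ y → return (rgt y) K t u) (rgt-∙ c x))

    return-rfind-suc : ∀ c x {y a m} → unpair x ≡ (a , m) →
      step w (return (suc y) (push 0 (c ∙ x) K) t u) ≡ eval c ⟨ a , suc m ⟩ K t u
    return-rfind-suc c x {a = a} {m} eq with lx , rx ← unpair≡⇒ {x} eq =
      trans (step-return 0 (c ∙ x)) (trans (cong₂ (λ c y → eval c (lft y ∙ suc (rgt y)) K t u) (lft-∙ c x) (rgt-∙ c x))
        (trans (cong₂ (λ a m → eval c (a ∙ suc m) K t u) lx rx) (cong (λ p → eval c p K t u) (∙≡⟨⟩ a (suc m)))))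

    return-pairˡ : ∀ c x {y} → step w (return y (push 1 (c ∙ x) K) t u) ≡ eval c x (push 4 y K) t u
    return-pairˡ c x {y} = trans (step-return 1 (c ∙ x))
      (cong₂ (λ c x → eval c x (push 4 y K) t u) (lft-∙ c x) (rgt-∙ c x))

    return-pairʳ : ∀ z {y} → step w (return y (push 4 z K) t u) ≡ return ⟨ z , y ⟩ K t u
    return-pairʳ z {y} = trans (step-return 4 z) (cong (λ p → return p K t u) (∙≡⟨⟩ z y))

    return-comp : ∀ c {y} → step w (return y (push 2 c K) t u) ≡ eval c y K t u
    return-comp c = step-return 2 c

    return-prec : ∀ c a n {y} →
      step w (return y (push 3 (c ∙ a ∙ n) K) t u) ≡ eval c ⟨ a , ⟨ n , y ⟩ ⟩ K t u
    return-prec c a n {y} = trans (step-return 3 (c ∙ a ∙ n))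
      (trans (cong₂ (λ c p → eval c (lft p ∙ rgt p ∙ y) K t u) (lft-∙ c (a ∙ n)) (rgt-∙ c (a ∙ n)))
      (trans (cong₂ (λ a n → eval c (a ∙ n ∙ y) K t u) (lft-∙ a n) (rgt-∙ a n))
        (cong (λ p → eval c p K t u) (trans (cong (a ∙_) (∙≡⟨⟩ n y)) (∙≡⟨⟩ a ⟨ n , y ⟩)))))

run : ℕ → ℕ → ℕ → ℕ
run w zero    σ = σ
run w (suc j) σ = run w j (step w σ)

-- Correctness of the universal machine

private
  infixr 5 _◅_ _◅◅_

  data Path (w : ℕ) : ℕ → ℕ → ℕ → Set where
    ε   : ∀ {σ} → Path w 0 σ σ
    _◅_ : ∀ {j σ₁ σ₂ σ₃} → step w σ₁ ≡ σ₂ → Path w j σ₂ σ₃ → Path w (suc j) σ₁ σ₃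

  _◅◅_ : ∀ {w i j σ₁ σ₂ σ₃} → Path w i σ₁ σ₂ → Path w j σ₂ σ₃ → Path w (i + j) σ₁ σ₃
  ε       ◅◅ q = q
  (e ◅ p) ◅◅ q = e ◅ (p ◅◅ q)

  run-path : ∀ {w j σ₁ σ₂} → Path w j σ₁ σ₂ → run w j σ₁ ≡ σ₂
  run-path ε          = refl
  run-path (refl ◅ p) = run-path p

  Final : ℕ → Set
  Final σ = ∃[ y ] ∃[ t ] ∃[ u ] σ ≡ return y 0 t u

  run-final : ∀ {w} j {σ} → Final σ → run w j σ ≡ σ
  run-final zero    _ = refl
  run-final {w} (suc j) (y , t , u , refl) =
    trans (cong (run w j) (step-halted {K = 0})) (run-final j (y , t , u , refl))

  -- Final configurations are fixed by `step`, so the truncated difference is right even when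
  -- `N < j`.
  run-final-path : ∀ {w j σ₁ σ₂} N → Final (run w N σ₁) → Path w j σ₁ σ₂ → Final (run w (N ∸ j) σ₂)
  run-final-path N       h ε          = h
  run-final-path (suc N) h (refl ◅ p) = run-final-path N h p
  run-final-path {w} {suc j} {σ₂ = σ} zero (y , t , u , refl) (refl ◅ p) =
    subst (λ k → Final (run w k σ)) (0∸n≡0 j) (run-final-path zero (y , t , u , step-halted {K = 0}) p)

  run-mono : ∀ {w M N σ} → M ≤ N → Final (run w M σ) → run w N σ ≡ run w M σ
  run-mono {N = N} z≤n     h = run-final N h
  run-mono         (s≤s p) h = run-mono p h

  -- Generality in the stack and the counters carries the induction through subprograms. Because of
  -- the bound on the path, `N + N` machine steps suffice in `result` for computations of length
  -- `N`.
  Evaluates : ℕ → Code → ℕ → ℕ → ℕ → ℕ → Set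
  Evaluates w c x y t u = ∀ {K t₀ u₀} → ∃[ j ] j < t + t ×
    Path w j (eval (encode c) x K t₀ u₀) (return y K (t₀ + t) (u₀ + u))

  time₂ : ∀ t₀ s t → suc t₀ + s + t ≡ t₀ + suc (s + t)
  time₂ = solve-∀

  steps₂ : ∀ {i j k s t} → k ≤ 1 → i < s + s → j < t + t →
           suc (i + suc (j + k)) < suc (s + t) + suc (s + t)
  steps₂ {i} {j} {k} {s} {t} k≤1 p q = subst₂ _≤_ (lhs i j k) (rhs s t) (+-mono-≤ (s≤s k≤1) (+-mono-≤ p q))
    where
    lhs : ∀ i j k → suc k + (suc i + suc j) ≡ suc (suc (i + suc (j + k)))
    lhs = solve-∀
    rhs : ∀ s t → 2 + (s + s + (t + t)) ≡ suc (s + t) + suc (s + t)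
    rhs = solve-∀

  steps₁ : ∀ {i k t} → k ≤ 1 → i < t + t → suc (i + k) < suc t + suc t
  steps₁ {i} {k} {t} k≤1 p = subst₂ _≤_ (lhs i k) (rhs t) (+-mono-≤ (s≤s k≤1) p)
    where
    lhs : ∀ i k → suc k + suc i ≡ suc (suc (i + k))
    lhs = solve-∀
    rhs : ∀ t → 2 + (t + t) ≡ suc t + suc t
    rhs = solve-∀

  one-step : ∀ {w y y′ K t₀ t u₀ u σ} → step w σ ≡ return y K (suc t₀) u → y ≡ y′ → t ≡ 1 → u ≡ u₀ →
           step w σ ≡ return y′ K (t₀ + t) u₀
  one-step {y = y} {K = K} {t₀} {u = u} p refl refl refl = trans p (cong (λ t → return y K t u) (+-comm 1 t₀))

  evaluates : ∀ {w c x y t} (d : D w ⊢ c ∙ x ⇓ y ∣ t) → Evaluates w c x y t (use d)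
  evaluates zero  = 1 , ≤-refl , one-step step-zero refl refl (sym (+-identityʳ _)) ◅ ε
  evaluates succ  = 1 , ≤-refl , one-step step-succ refl refl (sym (+-identityʳ _)) ◅ ε
  evaluates left  = 1 , ≤-refl , one-step step-left lft-def refl (sym (+-identityʳ _)) ◅ ε
  evaluates right = 1 , ≤-refl , one-step step-right rgt-def refl (sym (+-identityʳ _)) ◅ ε
  evaluates (oracle-∈ p) = 1 , ≤-refl , one-step (step-oracle-∈ p) refl refl refl ◅ ε
  evaluates (oracle-∉ p) = 1 , ≤-refl , one-step (step-oracle-∉ p) refl refl refl ◅ ε
  evaluates (pair {f} {g} {x} {y} {z} {s} {t} d e) {K} {t₀} {u₀} =
    let i , i< , p = evaluates d ; j , j< , q = evaluates e in
    suc (i + suc (j + 1)) , steps₂ {s = s} {t} ≤-refl i< j< ,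
    step-pair f g ◅ p ◅◅ return-pairˡ (encode g) x ◅ q ◅◅
      trans (return-pairʳ y) (cong₂ (return ⟨ y , z ⟩ K) (time₂ t₀ s t) (+-assoc u₀ (use d) (use e))) ◅ ε
  evaluates {w} (comp {f} {g} {x} {y} {z} {s} {t} d e) {K} {t₀} {u₀} =
    let i , i< , p = evaluates d ; j , j< , q = evaluates e in
    suc (i + suc (j + 0)) , steps₂ {s = s} {t} z≤n i< j< ,
    step-comp f g ◅ p ◅◅ return-comp (encode f) ◅ q ◅◅
      subst (Path w 0 _) (cong₂ (return z K) (time₂ t₀ s t) (+-assoc u₀ (use d) (use e))) ε
  evaluates {w} (prec-zero {f} {g} {x} {a} {y} {t} eq d) {K} {t₀} {u₀} =
    let i , i< , p = evaluates d in
    suc (i + 0) , steps₁ z≤n i< ,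
    step-prec-zero f g eq ◅ p ◅◅ subst (Path w 0 _) (cong (λ t → return y K t (u₀ + use d)) (sym (+-suc t₀ t))) ε
  evaluates {w} (prec-suc {f} {g} {x} {a} {n} {y} {z} {s} {t} eq d e) {K} {t₀} {u₀} =
    let i , i< , p = evaluates d ; j , j< , q = evaluates e in
    suc (i + suc (j + 0)) , steps₂ {s = s} {t} z≤n i< j< ,
    step-prec-suc f g eq ◅ p ◅◅ return-prec (encode g) a n ◅ q ◅◅
      subst (Path w 0 _) (cong₂ (return z K) (time₂ t₀ s t) (+-assoc u₀ (use d) (use e))) ε
  evaluates (rfind-zero {f} {x} {t} d) {K} {t₀} {u₀} =
    let i , i< , p = evaluates d in
    suc (i + 1) , steps₁ ≤-refl i< ,
    step-rfind f ◅ p ◅◅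
      trans (return-rfind-zero (encode (rfind f)) x)
        (cong₂ (λ y t → return y K t (u₀ + use d)) rgt-def (sym (+-suc t₀ t))) ◅ ε
  evaluates {w} (rfind-suc {f} {x} {a} {m} {v} {k} {s} {t} eq d e) {K} {t₀} {u₀} =
    let i , i< , p = evaluates d ; j , j< , q = evaluates e in
    suc (i + suc (j + 0)) , steps₂ {s = s} {t} z≤n i< j< ,
    step-rfind f ◅ p ◅◅ return-rfind-suc (encode (rfind f)) x eq ◅ q ◅◅
      subst (Path w 0 _) (cong₂ (return k K) (time₂ t₀ s t) (+-assoc u₀ (use d) (use e))) ε

  Halts : ℕ → Code → ℕ → Set
  Halts w c x = ∃[ y ] ∃[ t ] D w ⊢ c ∙ x ⇓ y ∣ t

  control : ∀ c x K t u → lft (rgt (rgt (config c x K t u))) ≡ c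
  control c x K t u = trans (cong (lft ∘ rgt) (rgt-∙ (t ∙ u) (K ∙ c ∙ x)))
    (trans (cong lft (rgt-∙ K (c ∙ x))) (lft-∙ c x))

  eval-not-final : ∀ {c x K t u} → ¬ Final (eval c x K t u)
  eval-not-final {c} {x} {K} {t} {u} (y , t′ , u′ , eq)
    with () ← trans (sym (control (suc c) x K t u))
                    (trans (cong (lft ∘ rgt ∘ rgt) eq) (control 0 y 0 t′ u′))

  -- Induction on the number of machine steps. A run that becomes final must finish each subprogram
  -- it starts; `evaluates` locates the return of the subprogram, after which fewer steps remain.
  halts : ∀ {w} F c {x K t u N} → N < F → Final (run w N (eval (encode c) x K t u)) → Halts w c x
  halts {w} (suc F) c {x} {K} {t} {u} {zero} _ h = contradiction h (eval-not-final {encode c} {x} {K} {t} {u})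
  halts zero    c ()
  halts (suc F) zero   _ h = _ , _ , zero
  halts (suc F) succ   _ h = _ , _ , succ
  halts (suc F) left   _ h = _ , _ , left
  halts (suc F) right  _ h = _ , _ , right
  halts {w} (suc F) oracle {x} _ h with D? w x
  ... | yes p = _ , _ , oracle-∈ p
  ... | no ¬p = _ , _ , oracle-∉ ¬p
  halts (suc F) (pair f g) {x} {N = suc N} (s≤s N<F) h =
    let _ , _ , d = halts F f N<F (run-final-path (suc N) h (step-pair f g ◅ ε))
        i , _ , p = evaluates d
        _ , _ , e = halts F g (≤-<-trans (m∸n≤m N (i + 1)) N<F)
          (run-final-path (suc N) h (step-pair f g ◅ p ◅◅ return-pairˡ (encode g) x ◅ ε))
    in _ , _ , pair d e
  halts (suc F) (comp f g) {N = suc N} (s≤s N<F) h =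
    let _ , _ , d = halts F g N<F (run-final-path (suc N) h (step-comp f g ◅ ε))
        i , _ , p = evaluates d
        _ , _ , e = halts F f (≤-<-trans (m∸n≤m N (i + 1)) N<F)
          (run-final-path (suc N) h (step-comp f g ◅ p ◅◅ return-comp (encode f) ◅ ε))
    in _ , _ , comp d e
  halts (suc F) (prec f g) {x} {N = suc N} (s≤s N<F) h with unpair x in eq
  ... | a , zero =
    let _ , _ , d = halts F f N<F (run-final-path (suc N) h (step-prec-zero f g eq ◅ ε))
    in _ , _ , prec-zero eq d
  ... | a , suc n =
    let _ , _ , d = halts F (prec f g) N<F (run-final-path (suc N) h (step-prec-suc f g eq ◅ ε))
        i , _ , p = evaluates d
        _ , _ , e = halts F g (≤-<-trans (m∸n≤m N (i + 1)) N<F)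
          (run-final-path (suc N) h (step-prec-suc f g eq ◅ p ◅◅ return-prec (encode g) a n ◅ ε))
    in _ , _ , prec-suc eq d e
  halts (suc F) (rfind f) {x} {N = suc N} (s≤s N<F) h
    with halts F f N<F (run-final-path (suc N) h (step-rfind f ◅ ε))
  ... | zero  , _ , d = _ , _ , rfind-zero d
  ... | suc v , _ , d =
    let i , _ , p = evaluates d
        _ , _ , e = halts F (rfind f) (≤-<-trans (m∸n≤m N (i + 1)) N<F)
          (run-final-path (suc N) h (step-rfind f ◅ p ◅◅ return-rfind-suc (encode (rfind f)) x refl ◅ ε))
    in _ , _ , rfind-suc refl d e

private
  resultᵣ : Fun 4
  resultᵣ = recᶠ (evalᶠ (var 0F) (var 1F) (lit 0) (lit 0) (lit 0))
    (call stepᶠ (var 4F ∷ var 1F ∷ [])) (var 3F +ᶠ var 3F)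

opaque
  unfolding step

  result : ℕ → ℕ → ℕ → ℕ → ℕ
  result c x w N = run w (N + N) (eval c x 0 0 0)

  result-def : ∀ c x w N → result c x w N ≡ run w (N + N) (eval c x 0 0 0)
  result-def c x w N = refl

  result-correct : ∀ c x w N → ⟦ resultᵣ ⟧ (c ∷ x ∷ w ∷ N ∷ []) ≡ result c x w N
  result-correct c x w N = go (N + N) (eval c x 0 0 0)
    where
    inner : ∀ k σ → primrec (step w σ) (λ _ → step w) k ≡ primrec σ (λ _ → step w) (suc k)
    inner zero    σ = refl
    inner (suc k) σ = cong (step w) (inner k σ)
    go : ∀ k σ → primrec σ (λ _ → step w) k ≡ run w k σ
    go zero    σ = refl
    go (suc k) σ = trans (sym (inner k σ)) (go k (step w σ))

resultᶠ : Fun 4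
resultᶠ = _≗by_ resultᵣ {g = λ { (c ∷ x ∷ w ∷ N ∷ []) → result c x w N }}
  λ { (c ∷ x ∷ w ∷ N ∷ []) → result-correct c x w N }

value queries : ℕ → ℕ → ℕ → ℕ → ℕ
value   c x w N = rgt (rgt (rgt (result c x w N)))
queries c x w N = rgt (lft (result c x w N))

-- A run of `N + N` machine steps may also finish computations longer than `N`. The third clause
-- excludes them, so that `In` matches `W[_,_]` exactly.
Runs : ℕ → ℕ → ℕ → ℕ → Set
Runs c x w N = let σ = result c x w N in
  lft (rgt (rgt σ)) ≡ 0 × lft (rgt σ) ≡ 0 × lft (lft σ) ≤ N

valueᶠ queriesᶠ : Fun 4
valueᶠ   = rgtᶠ (rgtᶠ (rgtᶠ resultᶠ))
queriesᶠ = rgtᶠ (lftᶠ resultᶠ)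

runsᵗ : Test 4
runsᵗ = sealed $ lftᶠ (rgtᶠ (rgtᶠ resultᶠ)) ≡ᵗ lit 0 ×ᵗ lftᶠ (rgtᶠ resultᶠ) ≡ᵗ lit 0
  ×ᵗ lftᶠ (lftᶠ resultᶠ) ≤ᵗ var 3F

private
  result-final : ∀ {c x w N} → Runs c x w N → Final (run w (N + N) (eval c x 0 0 0))
  result-final {c} {x} {w} {N} (p , q , _) = rgt (rgt (rgt σ)) , lft (lft σ) , rgt (lft σ) , (begin
    run w (N + N) (eval c x 0 0 0)                        ≡⟨ result-def c x w N ⟨
    σ                                                     ≡⟨ lft∙rgt σ ⟨
    lft σ ∙ rgt σ                                         ≡⟨ cong₂ _∙_ (sym (lft∙rgt (lft σ))) (sym (lft∙rgt (rgt σ))) ⟩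
    (lft (lft σ) ∙ rgt (lft σ)) ∙ lft (rgt σ) ∙ rgt (rgt σ)
      ≡⟨ cong₂ (λ K r → (lft (lft σ) ∙ rgt (lft σ)) ∙ K ∙ r) q
           (trans (sym (lft∙rgt (rgt (rgt σ)))) (cong (_∙ rgt (rgt (rgt σ))) p)) ⟩
    return (rgt (rgt (rgt σ))) 0 (lft (lft σ)) (rgt (lft σ)) ∎)
    where
    open ≡-Reasoning
    σ = result c x w N

  result-stable : ∀ {c x w M N} → M ≤ N → Runs c x w M → result c x w N ≡ result c x w M
  result-stable {c} {x} {w} {M} {N} M≤N r = trans (result-def c x w N)
    (trans (run-mono (+-mono-≤ M≤N M≤N) (result-final {c} r)) (sym (result-def c x w M)))

  result-evaluates : ∀ {w c x y t N} (d : D w ⊢ c ∙ x ⇓ y ∣ t) → t ≤ N →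
    result (encode c) x w N ≡ return y 0 t (use d)
  result-evaluates {w} {c} {x} {y} {t} {N} d t≤N = let j , j< , p = evaluates d in
    trans (result-def (encode c) x w N) (trans
      (run-mono (≤-trans (<⇒≤ j<) (+-mono-≤ t≤N t≤N)) (subst Final (sym (run-path p)) (y , t , use d , refl)))
      (run-path p))

module _ {c x w : ℕ} where

  runs-mono : ∀ {M N} → M ≤ N → Runs c x w M → Runs c x w N
  runs-mono M≤N r@(p , q , b) with eq ← result-stable {c} M≤N r =
    trans (cong (lft ∘ rgt ∘ rgt) eq) p , trans (cong (lft ∘ rgt) eq) q ,
    subst (_≤ _) (cong (lft ∘ lft) (sym eq)) (≤-trans b M≤N)

  value-stable : ∀ {M N} → M ≤ N → Runs c x w M → value c x w N ≡ value c x w M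
  value-stable M≤N r = cong (rgt ∘ rgt ∘ rgt) (result-stable {c} M≤N r)

module _ {w c x y t N} (d : D w ⊢ c ∙ x ⇓ y ∣ t) (t≤N : t ≤ N) where

  private
    σ₀ = return y 0 t (use d)
    eq : result (encode c) x w N ≡ σ₀
    eq = result-evaluates d t≤N

    rgt-σ₀ : rgt (rgt σ₀) ≡ 0 ∙ y
    rgt-σ₀ = trans (cong rgt (rgt-∙ (t ∙ use d) (0 ∙ 0 ∙ y))) (rgt-∙ 0 (0 ∙ y))
    lft-σ₀ : lft σ₀ ≡ t ∙ use d
    lft-σ₀ = lft-∙ (t ∙ use d) (0 ∙ 0 ∙ y)

  runs-complete : Runs (encode c) x w N
  runs-complete =
    trans (cong (lft ∘ rgt ∘ rgt) eq) (trans (cong lft rgt-σ₀) (lft-∙ 0 y)) ,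
    trans (cong (lft ∘ rgt) eq) (trans (cong lft (rgt-∙ (t ∙ use d) (0 ∙ 0 ∙ y))) (lft-∙ 0 (0 ∙ y))) ,
    subst (_≤ N) (sym (trans (cong (lft ∘ lft) eq) (trans (cong lft lft-σ₀) (lft-∙ t (use d))))) t≤N

  value-complete : value (encode c) x w N ≡ y
  value-complete = trans (cong (rgt ∘ rgt ∘ rgt) eq) (trans (cong rgt rgt-σ₀) (rgt-∙ 0 y))

  queries-complete : queries (encode c) x w N ≡ use d
  queries-complete = trans (cong (rgt ∘ lft) eq) (trans (cong rgt lft-σ₀) (rgt-∙ t (use d)))

runs-sound : ∀ c {x w N} → Runs (encode c) x w N →
  ∃[ t ] t ≤ N × Σ[ d ∈ D w ⊢ c ∙ x ⇓ value (encode c) x w N ∣ t ] queries (encode c) x w N ≡ use d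
runs-sound c {x} {w} {N} r@(_ , _ , b)
  with y , t , d ← halts (suc (N + N)) c {N = N + N} ≤-refl (result-final {encode c} r) =
    let t≤N = time≤N d in
    t , t≤N , subst (λ y → Σ[ d ∈ D w ⊢ c ∙ x ⇓ y ∣ t ] queries (encode c) x w N ≡ use d)
      (sym (value-complete d t≤N)) (d , queries-complete d t≤N)
  where
  -- The derivation obtained from `halts` has an unknown length `t`. At bound `N + t` the counter
  -- reads `t`, and by stability it already did so at `N`, where it is at most `N`.
  time≤N : ∀ {y t} → D w ⊢ c ∙ x ⇓ y ∣ t → t ≤ N
  time≤N {y} {t} d = subst (_≤ N)
    (trans (cong (lft ∘ lft) (trans (sym (result-stable {encode c} (m≤m+n N t) r)) (result-evaluates d (m≤n+m t N))))
      (trans (cong lft (lft-∙ (t ∙ use d) (0 ∙ 0 ∙ y))) (lft-∙ t (use d)))) b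

-- Stagewise enumeration of c.e. sets

D0-empty : ∀ x → ¬ D 0 x
D0-empty (suc x) p = D0-empty x p

-- Computations without oracle are run on the machine with the oracle index 0, which codes the empty
-- set.
∅⇒D0 : ∀ {c x y t} → ∅ ⊢ c ∙ x ⇓ y ∣ t → D 0 ⊢ c ∙ x ⇓ y ∣ t
∅⇒D0 d = use-principle d λ {z} _ → (λ ()) , λ _ → D0-empty z

D0⇒∅ : ∀ {c x y t} → D 0 ⊢ c ∙ x ⇓ y ∣ t → ∅ ⊢ c ∙ x ⇓ y ∣ t
D0⇒∅ d = use-principle d λ {z} _ → D0-empty z , λ _ ()

module _ {e} (canonical : Canonical e) where

  runs∅-complete : ∀ {x y t N} → ∅ ⊢ program e ∙ x ⇓ y ∣ t → t ≤ N → Runs e x 0 N × value e x 0 N ≡ y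
  runs∅-complete {x} {y} {N = N} d t≤N = subst (λ e → Runs e x 0 N × value e x 0 N ≡ y) canonical
    (runs-complete (∅⇒D0 d) t≤N , value-complete (∅⇒D0 d) t≤N)

  runs∅-sound : ∀ {x N} → Runs e x 0 N → ∃[ t ] t ≤ N × ∅ ⊢ program e ∙ x ⇓ value e x 0 N ∣ t
  runs∅-sound {x} {N} r =
    let t , t≤N , d , _ = runs-sound (program e) (subst (λ e → Runs e x 0 N) (sym canonical) r)
    in t , t≤N , subst (λ e′ → ∅ ⊢ program e ∙ x ⇓ value e′ x 0 N ∣ t) canonical (D0⇒∅ d)

In : ℕ → ℕ → ℕ → Set
In e s y = y < s × Runs e y 0 s

inᵗ : Test 3
inᵗ = sealed $ var 2F <ᵗ var 1F ×ᵗ callᵗ runsᵗ (var 0F ∷ var 2F ∷ lit 0 ∷ var 1F ∷ [])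

In-mono : ∀ {e s s′ y} → s ≤ s′ → In e s y → In e s′ y
In-mono {e} s≤s′ (y<s , r) = ≤-trans y<s s≤s′ , runs-mono {e} s≤s′ r

module _ {e} (canonical : Canonical e) where

  In⇒W : ∀ {s y} → In e s y → W[ e , s ] y
  In⇒W (y<s , r) = let t , t≤s , d = runs∅-sound canonical r in y<s , _ , t , t≤s , d

  W⇒In : ∀ {s y} → W[ e , s ] y → In e s y
  W⇒In (y<s , _ , _ , t≤s , d) = y<s , proj₁ (runs∅-complete canonical d t≤s)

-- The set X[ 2 , e , s ], provided that the indices are canonical.
In² : ℕ → ℕ → ℕ → Set
In² e s y = In (lft e) s y × ¬ In (lft (rgt e)) s y

in²ᵗ : Test 3
in²ᵗ = sealed $ callᵗ inᵗ (lftᶠ (var 0F) ∷ var 1F ∷ var 2F ∷ [])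
  ×ᵗ ¬ᵗ callᵗ inᵗ (lftᶠ (rgtᶠ (var 0F)) ∷ var 1F ∷ var 2F ∷ [])

-- What the construction uses of an index witnessing that a set is 2-tardy
-- for p.
record Witness (B : Pred ℕ 0ℓ) (stage : ℕ → Pred ℕ 0ℓ) (p : ℕ → ℕ) (e : ℕ) : Set where
  field
    arrives  : ∀ {y} → y ∉ B → ∃[ s₀ ] ∀ {s} → s₀ ≤ s → In² e s y
    tardy    : ∀ {y s} → In² e s y → y ∉ stage (p s)
    departed : ∀ {y s} → In (lft (rgt e)) s y → y ∈ B

module _ (em : ExcludedMiddle 0ℓ) {B} (E : Enumeration B) where

  open Enumeration E using (stage)

  -- Both c.e. indices are made canonical so that `In²` describes the approximation. An element
  -- outside `B` lies in `X 2 e`, hence never in the subtracted set; this gives `departed`.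
  witness : TardyVia 2 B E → (p : Fun 1) → let p′ = λ s → ⟦ p ⟧ (s ∷ []) in
    (∀ {s t} → s ≤ t → p′ s ≤ p′ t) → ∃ (Witness B stage p′)
  witness tardyVia p mono with tardyVia _ (⇒computable p) mono
  ... | e , X≐∁B , avoids = ê , record
    { arrives  = λ y∉B → arrives (proj₂ X≐∁B y∉B)
    ; tardy    = λ {y} {s} h → avoids y s (inj₁ (In²⇒ h))
    ; departed = departed }
    where
    i = proj₁ (unpair e)
    j = proj₁ (unpair (proj₂ (unpair e)))
    i′ = number (program i)
    j′ = number (program j)
    ê = i′ ∙ j′ ∙ 0

    lft-ê : lft ê ≡ i′
    lft-ê = lft-∙ i′ (j′ ∙ 0)
    lft-rgt-ê : lft (rgt ê) ≡ j′
    lft-rgt-ê = trans (cong lft (rgt-∙ i′ (j′ ∙ 0))) (lft-∙ j′ 0)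

    to : ∀ {k s y} → W[ number (program k) , s ] y → W[ k , s ] y
    to {k} {s} {y} = subst (λ c → y < s × ∃[ z ] ∃[ t ] t ≤ s × ∅ ⊢ c ∙ y ⇓ z ∣ t) (program-number (program k))
    from : ∀ {k s y} → W[ k , s ] y → W[ number (program k) , s ] y
    from {k} {s} {y} = subst (λ c → y < s × ∃[ z ] ∃[ t ] t ≤ s × ∅ ⊢ c ∙ y ⇓ z ∣ t)
      (sym (program-number (program k)))

    In-i⇒ : ∀ {s y} → In (lft ê) s y → W[ i , s ] y
    In-i⇒ {s} {y} h = to {i} (In⇒W (number-canonical (program i)) (subst (λ e → In e s y) lft-ê h))
    ⇒In-i : ∀ {s y} → W[ i , s ] y → In (lft ê) s y
    ⇒In-i {s} {y} h = subst (λ e → In e s y) (sym lft-ê) (W⇒In (number-canonical (program i)) (from {i} h))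
    In-j⇒ : ∀ {s y} → In (lft (rgt ê)) s y → W[ j , s ] y
    In-j⇒ {s} {y} h = to {j} (In⇒W (number-canonical (program j)) (subst (λ e → In e s y) lft-rgt-ê h))
    ⇒In-j : ∀ {s y} → W[ j , s ] y → In (lft (rgt ê)) s y
    ⇒In-j {s} {y} h = subst (λ e → In e s y) (sym lft-rgt-ê) (W⇒In (number-canonical (program j)) (from {j} h))

    In²⇒ : ∀ {s y} → In² ê s y → W[ i , s ] y × ¬ W[ j , s ] y
    In²⇒ (h , ¬h) = In-i⇒ h , λ k → ¬h (⇒In-j k)

    W-stage : ∀ {k s y} → W[ k , s ] y → W k y
    W-stage (_ , z , t , _ , d) = z , t , d

    arrives : ∀ {y} → y ∈ X 2 e → ∃[ s₀ ] ∀ {s} → s₀ ≤ s → In² ê s y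
    arrives {y} (inj₁ ((z , t , d) , y∉Wj)) = suc y + t , λ s₀≤s →
      ⇒In-i (≤-trans (m≤m+n (suc y) t) s₀≤s , z , t , ≤-trans (m≤n+m t (suc y)) s₀≤s , d) ,
      λ h → y∉Wj (W-stage {j} (In-j⇒ h))

    departed : ∀ {y s} → In (lft (rgt ê)) s y → y ∈ B
    departed {y} {s} h with em {y ∈ B}
    ... | yes y∈B = y∈B
    ... | no  y∉B with proj₂ X≐∁B y∉B
    ...   | inj₁ (_ , y∉Wj) = contradiction (W-stage {j} (In-j⇒ h)) y∉Wj

-- The construction

-- A follower is a number x = n ∙ e′ ∙ i with the owner n = (b ∙ Φ) ∙ e.

owner setup enumerator functional first second : ℕ → ℕ
owner x      = lft x
setup x      = lft (owner x)
enumerator x = lft (setup x)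
functional x = rgt (setup x)
first x      = rgt (owner x)
second x     = lft (rgt x)

-- Stage `s` looks at stage `rgt s` of the enumeration of B. Every number is `rgt s` for arbitrarily
-- large `s`, which gives the enumerating program time to halt.
oracleAt useAt : ℕ → ℕ → ℕ
oracleAt x s = value (enumerator x) (rgt s) 0 s
useAt x s    = queries (functional x) x (oracleAt x s) s

-- The clause `x ≤ s` bounds `x` by all later stages of its course; the bounded quantifiers in
-- `Caught-up` and `waitᵗ` rely on it.
Ready : ℕ → ℕ → Set
Ready x s = x ≤ s × Runs (enumerator x) (rgt s) 0 s
  × Runs (functional x) x (oracleAt x s) s × value (functional x) x (oracleAt x s) s ≡ 0
  × (∀ {y} → y < useAt x s → D (oracleAt x s) y ⊎ (In² (first x) s y × In² (second x) s y))

-- Departure of `y` from the first 2-c.e. set shows as its entry into the subtracted c.e. set.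
Refuted : ℕ → ℕ → ℕ → Set
Refuted x s₀ s = ∃[ y ] y < useAt x s₀ × ¬ D (oracleAt x s₀) y × In (lft (rgt (first x))) s y

Converged : ℕ → ℕ → ℕ → Set
Converged k x v = ∀ {i} → i < suc x → Runs k i 0 v

-- If pₖ is not known at `v` to converge up to `x`, then `x` has not joined Vᵏ and need not wait.
-- Otherwise the stage must have passed pₖ(v).
Released : ℕ → ℕ → ℕ → ℕ → Set
Released k x v s = Converged k x v → Runs k v 0 s × value k v 0 s ≤ s

private
  enumeratorᶠ functionalᶠ firstᶠ secondᶠ : ∀ {n} → Fun n → Fun n
  enumeratorᶠ x = lftᶠ (lftᶠ (lftᶠ x))
  functionalᶠ x = rgtᶠ (lftᶠ (lftᶠ x))
  firstᶠ x      = rgtᶠ (lftᶠ x)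
  secondᶠ x     = lftᶠ (rgtᶠ x)

oracleAtᶠ useAtᶠ : Fun 2
oracleAtᶠ = call valueᶠ (enumeratorᶠ (var 0F) ∷ rgtᶠ (var 1F) ∷ lit 0 ∷ var 1F ∷ [])
useAtᶠ    = call queriesᶠ (functionalᶠ (var 0F) ∷ var 0F ∷ oracleAtᶠ ∷ var 1F ∷ [])

readyᵗ : Test 2
readyᵗ = sealed $ x ≤ᵗ s ×ᵗ callᵗ runsᵗ (enumeratorᶠ x ∷ rgtᶠ s ∷ lit 0 ∷ s ∷ [])
  ×ᵗ callᵗ runsᵗ (functionalᶠ x ∷ x ∷ oracleAtᶠ ∷ s ∷ [])
  ×ᵗ call valueᶠ (functionalᶠ x ∷ x ∷ oracleAtᶠ ∷ s ∷ []) ≡ᵗ lit 0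
  ×ᵗ ∀<ᵗ useAtᶠ (var 0F ∈Dᵗ call oracleAtᶠ (var 1F ∷ var 2F ∷ [])
    ⊎ᵗ callᵗ in²ᵗ (firstᶠ (var 1F) ∷ var 2F ∷ var 0F ∷ [])
    ×ᵗ callᵗ in²ᵗ (secondᶠ (var 1F) ∷ var 2F ∷ var 0F ∷ []))
  where
  x = var 0F
  s = var 1F

refutedᵗ : Test 3
refutedᵗ = sealed $ ∃<ᵗ (call useAtᶠ (var 0F ∷ var 1F ∷ []))
  (¬ᵗ (var 0F ∈Dᵗ call oracleAtᶠ (var 1F ∷ var 2F ∷ []))
  ×ᵗ callᵗ inᵗ (lftᶠ (rgtᶠ (firstᶠ (var 1F))) ∷ var 3F ∷ var 0F ∷ []))

convergedᵗ : Test 3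
convergedᵗ = sealed $ ∀<ᵗ (sucᶠ (var 1F)) (callᵗ runsᵗ (var 1F ∷ var 0F ∷ lit 0 ∷ var 3F ∷ []))

releasedᵗ : Test 4
releasedᵗ = sealed $ callᵗ convergedᵗ (var 0F ∷ var 1F ∷ var 2F ∷ [])
  →ᵗ callᵗ runsᵗ args ×ᵗ call valueᶠ args ≤ᵗ var 3F
  where args = var 0F ∷ var 2F ∷ lit 0 ∷ var 3F ∷ []

-- In the state active k v s₀ the follower started at stage s₀, has left
-- the sets Vʲ for j ≥ k - 1, and did so for the last of these at stage v.

data State : Set where
  waiting   : State
  active    : (k v s₀ : ℕ) → State
  cancelled : State

-- Refutation takes precedence over advancing, so every departure happens while unrefuted. From
-- `active 0` there is no way back.
data Step (x s : ℕ) : State → State → Set where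
  start   : Ready x s → Step x s waiting (active (owner x) s s)
  idle    : ¬ Ready x s → Step x s waiting waiting
  cancel  : ∀ {k v s₀} → Refuted x s₀ s → Step x s (active (suc k) v s₀) cancelled
  advance : ∀ {k v s₀} → ¬ Refuted x s₀ s → Released k x v s →
            Step x s (active (suc k) v s₀) (active k s s₀)
  stay    : ∀ {k v s₀} → ¬ Refuted x s₀ s → ¬ Released k x v s →
            Step x s (active (suc k) v s₀) (active (suc k) v s₀)
  done    : ∀ {v s₀} → Step x s (active 0 v s₀) (active 0 v s₀)
  dead    : Step x s cancelled cancelled

-- Computability of the course of a follower

⌈_⌉ : State → ℕ
⌈ waiting ⌉       = 0
⌈ active k v s₀ ⌉ = 2 + (k ∙ v ∙ s₀)
⌈ cancelled ⌉     = 1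

private
  start? : ∀ {x s} → Dec (Ready x s) → ∃ (Step x s waiting)
  start? (yes r) = _ , start r
  start? (no ¬r) = _ , idle ¬r

  advance? : ∀ {x s k v s₀} → Dec (Refuted x s₀ s) → Dec (Released k x v s) → ∃ (Step x s (active (suc k) v s₀))
  advance? (yes r) _       = _ , cancel r
  advance? (no ¬r) (yes l) = _ , advance ¬r l
  advance? (no ¬r) (no ¬l) = _ , stay ¬r ¬l

  next-state : ∀ x s σ → ∃ (Step x s σ)
  next-state x s waiting               = start? (holds? readyᵗ (x ∷ s ∷ []))
  next-state x s (active zero v s₀)    = _ , done
  next-state x s (active (suc k) v s₀) =
    advance? (holds? refutedᵗ (x ∷ s₀ ∷ s ∷ [])) (holds? releasedᵗ (k ∷ x ∷ v ∷ s ∷ []))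
  next-state x s cancelled             = _ , dead

  -- x ∷ s ∷ k ∷ v ∷ s₀ ∷ []
  activeᶠ : Fun 5
  activeᶠ = ifᵗ (k ≡ᵗ lit 0) σ
    (ifᵗ (callᵗ refutedᵗ (x ∷ s₀ ∷ s ∷ [])) (lit 1)
    (ifᵗ (callᵗ releasedᵗ (predᶠ k ∷ x ∷ v ∷ s ∷ [])) (sucᶠ (sucᶠ (predᶠ k ∙ᶠ s ∙ᶠ s₀))) σ))
    where
    x = var 0F
    s = var 1F
    k = var 2F
    v = var 3F
    s₀ = var 4F
    σ = sucᶠ (sucᶠ (k ∙ᶠ v ∙ᶠ s₀))

  -- x ∷ s ∷ ⌈ σ ⌉ ∷ []
  nextᶠ : Fun 3
  nextᶠ = ifᵗ (σ ≡ᵗ lit 0) (ifᵗ (callᵗ readyᵗ (x ∷ s ∷ [])) (sucᶠ (sucᶠ (lftᶠ x ∙ᶠ s ∙ᶠ s))) (lit 0))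
    (ifᵗ (σ ≡ᵗ lit 1) (lit 1)
      (call activeᶠ (x ∷ s ∷ lftᶠ a ∷ lftᶠ (rgtᶠ a) ∷ rgtᶠ (rgtᶠ a) ∷ [])))
    where
    x = var 0F
    s = var 1F
    σ = var 2F
    a = σ ∸ᶠ lit 2

  next-active : ∀ {x s} k v s₀ →
    ⟦ nextᶠ ⟧ (x ∷ s ∷ ⌈ active k v s₀ ⌉ ∷ []) ≡ ⟦ activeᶠ ⟧ (x ∷ s ∷ k ∷ v ∷ s₀ ∷ [])
  next-active {x} {s} k v s₀ = trans
    (cong₂ (λ k a → ⟦ activeᶠ ⟧ (x ∷ s ∷ k ∷ lft a ∷ rgt a ∷ [])) (lft-∙ k (v ∙ s₀)) (rgt-∙ k (v ∙ s₀)))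
    (cong₂ (λ v s₀ → ⟦ activeᶠ ⟧ (x ∷ s ∷ k ∷ v ∷ s₀ ∷ [])) (lft-∙ v s₀) (rgt-∙ v s₀))

  next-code : ∀ {x s σ τ} → Step x s σ τ → ⟦ nextᶠ ⟧ (x ∷ s ∷ ⌈ σ ⌉ ∷ []) ≡ ⌈ τ ⌉
  next-code {x} {s} (start r) =
    ifᵗ-true (callᵗ readyᵗ (var 0F ∷ var 1F ∷ [])) {v = x ∷ s ∷ 0 ∷ []} r
  next-code {x} {s} (idle ¬r) =
    ifᵗ-false (callᵗ readyᵗ (var 0F ∷ var 1F ∷ [])) {v = x ∷ s ∷ 0 ∷ []} ¬r
  next-code {x} {s} (cancel {k} {v} {s₀} r) = trans (next-active (suc k) v s₀)
    (ifᵗ-true (callᵗ refutedᵗ (var 0F ∷ var 4F ∷ var 1F ∷ [])) {v = x ∷ s ∷ suc k ∷ v ∷ s₀ ∷ []} r)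
  next-code {x} {s} (advance {k} {v} {s₀} ¬r l) = trans (next-active (suc k) v s₀)
    (trans (ifᵗ-false (callᵗ refutedᵗ (var 0F ∷ var 4F ∷ var 1F ∷ [])) {v = x ∷ s ∷ suc k ∷ v ∷ s₀ ∷ []} ¬r)
    (ifᵗ-true (callᵗ releasedᵗ (predᶠ (var 2F) ∷ var 0F ∷ var 3F ∷ var 1F ∷ []))
      {v = x ∷ s ∷ suc k ∷ v ∷ s₀ ∷ []} l))
  next-code {x} {s} (stay {k} {v} {s₀} ¬r ¬l) = trans (next-active (suc k) v s₀)
    (trans (ifᵗ-false (callᵗ refutedᵗ (var 0F ∷ var 4F ∷ var 1F ∷ [])) {v = x ∷ s ∷ suc k ∷ v ∷ s₀ ∷ []} ¬r)
    (ifᵗ-false (callᵗ releasedᵗ (predᶠ (var 2F) ∷ var 0F ∷ var 3F ∷ var 1F ∷ []))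
      {v = x ∷ s ∷ suc k ∷ v ∷ s₀ ∷ []} ¬l))
  next-code (done {v} {s₀}) = next-active 0 v s₀
  next-code dead = refl

  stateᵣ : Fun 2
  stateᵣ = recᶠ (lit 0) (call nextᶠ (var 2F ∷ var 0F ∷ var 1F ∷ [])) (var 1F)

opaque

  S : ℕ → ℕ → State
  S x zero    = waiting
  S x (suc s) = proj₁ (next-state x s (S x s))

  S-zero : ∀ x → S x 0 ≡ waiting
  S-zero x = refl

  S-step : ∀ x s → Step x s (S x s) (S x (suc s))
  S-step x s = proj₂ (next-state x s (S x s))

S-code : ∀ x s → ⟦ stateᵣ ⟧ (x ∷ s ∷ []) ≡ ⌈ S x s ⌉
S-code x zero    = sym (cong ⌈_⌉ (S-zero x))
S-code x (suc s) = trans (cong (λ σ → ⟦ nextᶠ ⟧ (x ∷ s ∷ σ ∷ [])) (S-code x s)) (next-code (S-step x s))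

stateᶠ : Fun 2
stateᶠ = _≗by_ stateᵣ {g = λ { (x ∷ s ∷ []) → ⌈ S x s ⌉ }} λ { (x ∷ s ∷ []) → S-code x s }

-- Reached k: the follower has left the sets Vʲ for all j ≥ k - 1.
Reached : ℕ → State → Set
Reached k waiting        = ⊥
Reached k (active j _ _) = j ≤ k
Reached k cancelled      = ⊥

mapᵗ : (T : Test n) {P : Vec ℕ n → Set} → (∀ v → Holds T v → P v) → (∀ v → P v → Holds T v) → Test n
mapᵗ T {P} f g = record
  { Holds = P ; char = char T ; sound = λ v p → f v (sound T v p) ; complete = λ v h → complete T v (g v h) }

-- k ∷ x ∷ s ∷ []
reachedᵗ : Test 3
reachedᵗ = mapᵗ (lit 2 ≤ᵗ σ ×ᵗ lftᶠ (σ ∸ᶠ lit 2) ≤ᵗ var 0F) {λ { (k ∷ x ∷ s ∷ []) → Reached k (S x s) }}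
  (λ { (k ∷ x ∷ s ∷ []) → to k (S x s) }) (λ { (k ∷ x ∷ s ∷ []) → from k (S x s) })
  where
  σ = call stateᶠ (var 1F ∷ var 2F ∷ [])
  to : ∀ k σ → 2 ≤ ⌈ σ ⌉ × lft (⌈ σ ⌉ ∸ 2) ≤ k → Reached k σ
  to k (active j v s₀) (_ , p) = subst (_≤ k) (lft-∙ j (v ∙ s₀)) p
  to k cancelled (s≤s () , _)
  from : ∀ k σ → Reached k σ → 2 ≤ ⌈ σ ⌉ × lft (⌈ σ ⌉ ∸ 2) ≤ k
  from k (active j v s₀) p = s≤s (s≤s z≤n) , subst (_≤ k) (sym (lft-∙ j (v ∙ s₀))) p

cancelledᵗ waitingᵗ : Test 2
cancelledᵗ = mapᵗ (stateᶠ ≡ᵗ lit 1) {λ { (x ∷ s ∷ []) → S x s ≡ cancelled }}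
  (λ { (x ∷ s ∷ []) → to (S x s) }) (λ { (x ∷ s ∷ []) → cong ⌈_⌉ })
  where
  to : ∀ σ → ⌈ σ ⌉ ≡ 1 → σ ≡ cancelled
  to cancelled _ = refl
waitingᵗ = mapᵗ (stateᶠ ≡ᵗ lit 0) {λ { (x ∷ s ∷ []) → S x s ≡ waiting }}
  (λ { (x ∷ s ∷ []) → to (S x s) }) (λ { (x ∷ s ∷ []) → cong ⌈_⌉ })
  where
  to : ∀ σ → ⌈ σ ⌉ ≡ 0 → σ ≡ waiting
  to waiting _ = refl

-- The course of a single follower

Starts : ℕ → ℕ → Set
Starts x s₀ = S x s₀ ≡ waiting × Ready x s₀

startsᵗ : Test 2
startsᵗ = waitingᵗ ×ᵗ readyᵗ

Ready⇒¬Refuted : ∀ {x s} → Ready x s → ¬ Refuted x s s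
Ready⇒¬Refuted (_ , _ , _ , _ , settled) (y , y<u , y∉w , y∈j) with settled y<u
... | inj₁ y∈w                 = y∉w y∈w
... | inj₂ ((_ , y∉j) , _) = y∉j y∈j

Converged-mono : ∀ {k x v v′} → v ≤ v′ → Converged k x v → Converged k x v′
Converged-mono {k} v≤v′ c i≤x = runs-mono {k} v≤v′ (c i≤x)

persists : ∀ {x} (P : State → Set) → (∀ {s σ τ} → Step x s σ τ → P σ → P τ) →
           ∀ {s s′} → s ≤ s′ → P (S x s) → P (S x s′)
persists {x} P f {s} s≤s′ p = go (≤⇒≤′ s≤s′)
  where
  go : ∀ {s′} → s ≤′ s′ → P (S x s′)
  go (≤′-reflexive refl) = p
  go (≤′-step q)         = f (S-step x _) (go q)

module _ {x : ℕ} where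

  cancelled-persists : ∀ {s s′} → s ≤ s′ → S x s ≡ cancelled → S x s′ ≡ cancelled
  cancelled-persists = persists (_≡ cancelled) λ { dead _ → refl }

  done-persists : ∀ {s s′ v s₀} → s ≤ s′ → S x s ≡ active 0 v s₀ → S x s′ ≡ active 0 v s₀
  done-persists {v = v} {s₀} = persists (_≡ active 0 v s₀) λ { done eq → eq }

  Alive : ℕ → ℕ → State → Set
  Alive k s₀ τ = ∃[ j ] ∃[ v ] τ ≡ active j v s₀ × j ≤ k

  Killed : ℕ → State → Set
  Killed s₀ τ = τ ≡ cancelled × ∃[ r ] Refuted x s₀ r

  later : ∀ {k v s₀ s s′} → s ≤ s′ → S x s ≡ active k v s₀ → Killed s₀ (S x s′) ⊎ Alive k s₀ (S x s′)
  later {k} {v} {s₀} s≤s′ eq = persists (λ τ → Killed s₀ τ ⊎ Alive k s₀ τ) go s≤s′ (inj₂ (k , v , eq , ≤-refl))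
    where
    go : ∀ {s σ τ} → Step x s σ τ → Killed s₀ σ ⊎ Alive k s₀ σ → Killed s₀ τ ⊎ Alive k s₀ τ
    go (cancel r)    (inj₂ (_ , _ , refl , _))   = inj₁ (refl , _ , r)
    go (advance _ _) (inj₂ (_ , _ , refl , j≤k)) = inj₂ (_ , _ , refl , <⇒≤ j≤k)
    go (stay _ _)    (inj₂ (_ , _ , refl , j≤k)) = inj₂ (_ , _ , refl , j≤k)
    go done          (inj₂ (_ , _ , refl , j≤k)) = inj₂ (_ , _ , refl , j≤k)
    go dead          (inj₁ h)                    = inj₁ h

  -- Here `v` is the stage of the latest departure. The departure shows in the state one stage
  -- later, whence `suc v` in `since`.
  record Invariant (k v s₀ s : ℕ) : Set where
    field
      v<s        : v < s
      s₀≤v       : s₀ ≤ v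
      starts     : Starts x s₀
      k≤owner    : k ≤ owner x
      unrefuted  : ¬ Refuted x s₀ v
      since      : S x (suc v) ≡ active k v s₀

  invariant : ∀ s {k v s₀} → S x s ≡ active k v s₀ → Invariant k v s₀ s
  invariant zero    eq with () ← trans (sym (S-zero x)) eq
  invariant (suc s) eq = go refl refl (S-step x s) eq
    where
    go : ∀ {σ τ k v s₀} → S x s ≡ σ → S x (suc s) ≡ τ → Step x s σ τ → τ ≡ active k v s₀ →
         Invariant k v s₀ (suc s)
    go p q (start r) refl = record
      { v<s = ≤-refl ; s₀≤v = ≤-refl ; starts = p , r ; k≤owner = ≤-refl
      ; unrefuted = Ready⇒¬Refuted {x} r ; since = q }
    go p q (advance ¬r _) refl = let open Invariant (invariant s p) in record
      { v<s = ≤-refl ; s₀≤v = ≤-trans s₀≤v (<⇒≤ v<s) ; starts = starts ; k≤owner = <⇒≤ k≤owner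
      ; unrefuted = ¬r ; since = q }
    go p q (stay _ _) refl = record { Invariant (invariant s p) ; v<s = m<n⇒m<1+n (Invariant.v<s (invariant s p)) }
    go p q done refl = record { Invariant (invariant s p) ; v<s = m<n⇒m<1+n (Invariant.v<s (invariant s p)) }

  started : ∀ {s₀} → Starts x s₀ → S x (suc s₀) ≡ active (owner x) s₀ s₀
  started {s₀} (p , r) = go p (S-step x s₀)
    where
    go : ∀ {σ τ} → σ ≡ waiting → Step x s₀ σ τ → τ ≡ active (owner x) s₀ s₀
    go refl (start _) = refl
    go refl (idle ¬r) = contradiction r ¬r

  -- A follower that is no longer waiting when ready must have started before; tracing its states
  -- back finds the start.
  eventually-starts : ∀ {s} → Ready x s → ∃[ s₀ ] Starts x s₀
  eventually-starts {s} r = go refl r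
    where
    search-back : ∀ s → ¬ S x s ≡ waiting → ∃[ s₀ ] Starts x s₀
    step-back : ∀ {σ τ} s → S x s ≡ σ → Step x s σ τ → ¬ τ ≡ waiting → ∃[ s₀ ] Starts x s₀
    search-back zero    ¬w = contradiction (S-zero x) ¬w
    search-back (suc s) ¬w = step-back s refl (S-step x s) ¬w
    step-back s eq (start r)     _  = s , eq , r
    step-back s eq (idle _)      ¬w = contradiction refl ¬w
    step-back s eq (cancel _)    _  = search-back s λ w → case trans (sym eq) w of λ ()
    step-back s eq (advance _ _) _  = search-back s λ w → case trans (sym eq) w of λ ()
    step-back s eq (stay _ _)    _  = search-back s λ w → case trans (sym eq) w of λ ()
    step-back s eq done          _  = search-back s λ w → case trans (sym eq) w of λ ()
    step-back s eq dead          _  = search-back s λ w → case trans (sym eq) w of λ ()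
    go : ∀ {σ} → S x s ≡ σ → Ready x s → ∃[ s₀ ] Starts x s₀
    go {waiting}      eq r = s , eq , r
    go {active _ _ _} eq r = search-back s λ w → case trans (sym eq) w of λ ()
    go {cancelled}    eq r = search-back s λ w → case trans (sym eq) w of λ ()

  -- The follower leaves Vᵏ at stage v, and if it was in Vᵏ by then, it moves
  -- on only after the value of the k-th partial computable function at v.
  passage : ∀ {k} → k < owner x → ∀ s {k′ v′ s₀} → S x s ≡ active k′ v′ s₀ → k′ ≤ k →
    ∃[ v ] S x (suc v) ≡ active (suc k) v s₀ ×
      (Converged k x v → ∃[ r ] r ≤ v′ × Runs k v 0 r × value k v 0 r ≤ r)
  passage k<n zero eq with () ← trans (sym (S-zero x)) eq
  passage {k} k<n (suc s) eq k′≤k = go refl (S-step x s) eq k′≤k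
    where
    Passage : ℕ → ℕ → Set
    Passage v′ s₀ = ∃[ v ] S x (suc v) ≡ active (suc k) v s₀ ×
      (Converged k x v → ∃[ r ] r ≤ v′ × Runs k v 0 r × value k v 0 r ≤ r)
    go : ∀ {σ τ k′ v′ s₀} → S x s ≡ σ → Step x s σ τ → τ ≡ active k′ v′ s₀ → k′ ≤ k → Passage v′ s₀
    go p (start _) refl k′≤k = contradiction k<n (≤⇒≯ k′≤k)
    go p (advance {k′} {v} _ l) refl k′≤k with m≤n⇒m<n∨m≡n k′≤k
    ... | inj₂ refl = v , Invariant.since (invariant s p) , λ c → s , ≤-refl , l c
    ... | inj₁ k′<k = let w , q , f = passage k<n s p k′<k in
      w , q , λ c → let r , r≤ , h = f c in r , ≤-trans r≤ (<⇒≤ (Invariant.v<s (invariant s p))) , h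
    go p (stay _ _) refl k′≤k = passage k<n s p k′≤k
    go p done       refl k′≤k = passage k<n s p k′≤k

  -- For each k, total or not, this holds for all but finitely many x.
  Good : ℕ → Set
  Good k = ∀ {v} → Converged k x v → ∃[ s ] Runs k v 0 s

  -- No wait lasts forever: either convergence up to `x` is unknown at `v` and the follower is
  -- released at once, or goodness makes the awaited value exist.
  resolves : ∀ k → (∀ {j} → j < k → Good j) → ∀ {s v s₀} → S x s ≡ active k v s₀ →
    ∃[ s′ ] (Killed s₀ (S x s′) ⊎ ∃[ v′ ] S x s′ ≡ active 0 v′ s₀)
  resolves zero    good {s} eq = s , inj₂ (_ , eq)
  resolves (suc k) good {s} {v} {s₀} eq = let r , l = release in
    continue (wait (r + s) eq refl (l (≤-trans (m≤m+n r s) (m≤m+n (r + s) s))))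
    where
    release : ∃[ r ] ∀ {s} → r ≤ s → Released k x v s
    release = release? (holds? convergedᵗ (k ∷ x ∷ v ∷ []))
      where
      release? : Dec (Converged k x v) → ∃[ r ] ∀ {s} → r ≤ s → Released k x v s
      release? (no ¬c) = 0 , λ _ c → ⊥-elim (¬c c)
      release? (yes c) = let s , h = good ≤-refl c in s + value k v 0 s , λ p _ →
        runs-mono {k} (≤-trans (m≤m+n s _) p) h ,
        ≤-trans (≤-reflexive (value-stable {k} (≤-trans (m≤m+n s _) p) h)) (≤-trans (m≤n+m _ s) p)
    Moved : Set
    Moved = ∃[ s′ ] (Killed s₀ (S x s′) ⊎ ∃[ v′ ] S x s′ ≡ active k v′ s₀)
    wait : ∀ d {s t} → S x s ≡ active (suc k) v s₀ → d + s ≡ t → Released k x v t → Moved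
    move : ∀ d {s t τ} → Step x s (active (suc k) v s₀) τ → S x (suc s) ≡ τ → d + s ≡ t → Released k x v t → Moved
    wait d {s} eq e l = move d (subst (λ σ → Step x s σ (S x (suc s))) eq (S-step x s)) refl e l
    move d       {s} (cancel r)    q _ _ = suc s , inj₁ (q , _ , r)
    move d       {s} (advance _ _) q _ _ = suc s , inj₂ (s , q)
    move zero    (stay _ ¬l)   q refl l = contradiction l ¬l
    move (suc d) {s} (stay _ _)    q e l = wait d q (trans (+-suc d s) e) l
    continue : Moved → ∃[ s′ ] (Killed s₀ (S x s′) ⊎ ∃[ v′ ] S x s′ ≡ active 0 v′ s₀)
    continue (s′ , inj₁ h)       = s′ , inj₁ h
    continue (s′ , inj₂ (_ , q)) = resolves k (λ j<k → good (m<n⇒m<1+n j<k)) q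

-- The set A

Done : ℕ → ℕ → Set
Done x s = Reached 0 (S x s)

-- Among the followers with the same owner only the first one that is
-- done enters A. The number q codes the follower lft q at the stage rgt q.
Win : ℕ → Set
Win q = Done (lft q) (rgt q) ×
  (∀ {r} → r < q → Done (lft r) (rgt r) × owner (lft r) ≡ owner (lft q) → lft r ≡ lft q)

winᵗ : Test 1
winᵗ = sealed $ callᵗ reachedᵗ (lit 0 ∷ lftᶠ (var 0F) ∷ rgtᶠ (var 0F) ∷ [])
  ×ᵗ ∀<ᵗ (var 0F) (callᵗ reachedᵗ (lit 0 ∷ lftᶠ (var 0F) ∷ rgtᶠ (var 0F) ∷ [])
    ×ᵗ lftᶠ (lftᶠ (var 0F)) ≡ᵗ lftᶠ (lftᶠ (var 1F)) →ᵗ lftᶠ (var 0F) ≡ᵗ lftᶠ (var 1F))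

Lost : ℕ → ℕ → Set
Lost x s = ∃[ q ] q < s × Win q × owner (lft q) ≡ owner x × ¬ lft q ≡ x

lostᵗ : Test 2
lostᵗ = sealed $ ∃<ᵗ (var 1F) (callᵗ winᵗ (var 0F ∷ []) ×ᵗ lftᶠ (lftᶠ (var 0F)) ≡ᵗ lftᶠ (var 1F)
  ×ᵗ ¬ᵗ (lftᶠ (var 0F) ≡ᵗ var 1F))

A : Pred ℕ 0ℓ
A x = ∃[ q ] Win q × lft q ≡ x

-- The minimality clause of the larger code, applied to the smaller one, identifies the followers.
-- Several codes may win, but only with the same follower.
win-unique : ∀ {q r} → Win q → Win r → owner (lft q) ≡ owner (lft r) → lft q ≡ lft r
win-unique {q} {r} (dq , first-q) (dr , first-r) eq with <-cmp q r
... | tri< q<r _ _  = first-r q<r (dq , eq)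
... | tri≈ _ refl _ = refl
... | tri> _ _ r<q  = sym (first-q r<q (dr , sym eq))

win-exists : ∀ {x s} → Done x s → ∃[ q ] Win q × owner (lft q) ≡ owner x
win-exists {x} {s} d = winner (least {P} dec {x ∙ s}
  (subst₂ Done (sym (lft-∙ x s)) (sym (rgt-∙ x s)) d , cong owner (lft-∙ x s)))
  where
  P : ℕ → Set
  P q = Done (lft q) (rgt q) × owner (lft q) ≡ owner x
  dec : ∀ q → Dec (P q)
  dec q = holds? reachedᵗ (0 ∷ lft q ∷ rgt q ∷ []) ×-dec (owner (lft q) ≟ owner x)
  winner : ∃ (Least P) → ∃[ q ] Win q × owner (lft q) ≡ owner x
  winner (q , (d , eq) , below) = q ,
    (d , λ r<q (d′ , eq′) → contradiction r<q (≤⇒≯ (below (d′ , trans eq′ eq)))) , eq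

done-active : ∀ {x s} → Done x s → ∃[ v ] ∃[ s₀ ] S x s ≡ active 0 v s₀
done-active {x} {s} = go (S x s)
  where
  go : ∀ σ → Reached 0 σ → ∃[ v ] ∃[ s₀ ] σ ≡ active 0 v s₀
  go (active zero v s₀) _ = v , s₀ , refl

active-done : ∀ {x s v s₀} → S x s ≡ active 0 v s₀ → Done x s
active-done eq = subst (Reached 0) (sym eq) z≤n

A-active : ∀ {x} → x ∈ A → ∃[ s ] ∃[ v ] ∃[ s₀ ] S x s ≡ active 0 v s₀
A-active (q , (d , _) , refl) = rgt q , done-active d

cancelled∉A : ∀ {x s} → S x s ≡ cancelled → x ∉ A
cancelled∉A {x} {s} c x∈A with s′ , v , s₀ , p ← A-active x∈A with ≤-total s s′
... | inj₁ s≤s′ = case trans (sym (cancelled-persists s≤s′ c)) p of λ ()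
... | inj₂ s′≤s = case trans (sym (done-persists s′≤s p)) c of λ ()

lost∉A : ∀ {x s} → Lost x s → x ∉ A
lost∉A (q , _ , win , same , lft≢) (r , win′ , refl) = lft≢ (win-unique win win′ same)

memberᵗ : Test 2
memberᵗ = callᵗ winᵗ (var 0F ∷ []) ×ᵗ lftᶠ (var 0F) ≡ᵗ var 1F

A-ce : CE A
A-ce = W-index memberᵗ , (λ (q , h) → W-index-complete memberᵗ {s = q} h) , W-index-sound memberᵗ

-- Canonical indices of finite sets

private

  halve-double : ∀ r → ⌊ r + r /2⌋ ≡ r × ⌊ suc (r + r) /2⌋ ≡ r
  halve-double zero    = refl , refl
  halve-double (suc r) rewrite +-suc r r = let p , q = halve-double r in cong suc p , cong suc q

  parity-double : ∀ r → (r + r) % 2 ≡ 0 × suc (r + r) % 2 ≡ 1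
  parity-double zero    = refl , refl
  parity-double (suc r) rewrite +-suc r r = parity-double r

bit : {P : Set} → Dec P → ℕ → ℕ
bit (yes _) r = suc (r + r)
bit (no  _) r = r + r

D-bit-zero : ∀ {P} (P? : Dec P) r → (D (bit P? r) 0 → P) × (P → D (bit P? r) 0)
D-bit-zero (yes p) r = (λ _ → p) , λ _ → proj₂ (parity-double r)
D-bit-zero (no ¬p) r = (λ h → case trans (sym (proj₁ (parity-double r))) h of λ ()) , λ p → contradiction p ¬p

half-bit : ∀ {P} (P? : Dec P) r → ⌊ bit P? r /2⌋ ≡ r
half-bit (yes _) r = proj₂ (halve-double r)
half-bit (no  _) r = proj₁ (halve-double r)

-- Excluded middle chooses the bits. The resulting number can then be built into a program as a
-- constant.
finite-set : ExcludedMiddle 0ℓ → (P : Pred ℕ 0ℓ) → ∀ M →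
  ∃[ w ] ∀ {x} → x < M → (D w x → P x) × (P x → D w x)
finite-set em P zero    = 0 , λ ()
finite-set em P (suc M) = bit (em {P 0}) r , spec
  where
  r = proj₁ (finite-set em (P ∘ suc) M)
  spec : ∀ {x} → x < suc M → (D (bit (em {P 0}) r) x → P x) × (P x → D (bit (em {P 0}) r) x)
  spec {zero}  _         = D-bit-zero em r
  spec {suc x} (s≤s x<M) = subst (λ r → (D r x → P (suc x)) × (P (suc x) → D r x))
    (sym (half-bit em r)) (proj₂ (finite-set em (P ∘ suc) M) x<M)

module _ (T : Test 2) where

  private
    setᵣ : Fun 1
    setᵣ = recᶠ (lit 0) (ifᵗ (callᵗ T (var 2F ∸ᶠ sucᶠ (var 0F) ∷ var 2F ∷ [])) (sucᶠ r+r) r+r) (var 0F)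
      where r+r = var 1F +ᶠ var 1F

    set : ℕ → ℕ → ℕ
    set s = primrec 0 (λ j r → ifzero (⟦ char T ⟧ (s ∸ suc j ∷ s ∷ [])) (suc (r + r)) (r + r))

    set-suc : ∀ s j → set s (suc j) ≡ bit (holds? T (s ∸ suc j ∷ s ∷ [])) (set s j)
    set-suc s j = go (holds? T (s ∸ suc j ∷ s ∷ []))
      where
      go : (h : Dec (Holds T (s ∸ suc j ∷ s ∷ []))) → set s (suc j) ≡ bit h (set s j)
      go (yes h) = ifᵗ-true T h
      go (no ¬h) = ifᵗ-false T ¬h

    -- Bits are prepended from `s ∸ 1` down to 0, each new one doubling the rest; after `j` rounds,
    -- bit `y` stands for the number `a + y`.
    set-spec : ∀ s j a → a + j ≡ s → ∀ y →
      (D (set s j) y → y < j × Holds T (a + y ∷ s ∷ [])) × (y < j → Holds T (a + y ∷ s ∷ []) → D (set s j) y)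
    set-spec s zero    a eq y = (λ h → contradiction h (D0-empty y)) , λ ()
    set-spec s (suc j) a eq y rewrite set-suc s j | trans (cong (_∸ suc j) (sym eq)) (m+n∸n≡m a (suc j)) = go y
      where
      b = holds? T (a ∷ s ∷ [])
      go : ∀ y → (D (bit b (set s j)) y → y < suc j × Holds T (a + y ∷ s ∷ [])) ×
                 (y < suc j → Holds T (a + y ∷ s ∷ []) → D (bit b (set s j)) y)
      go zero rewrite +-identityʳ a = let f , g = D-bit-zero b (set s j) in
        (λ h → s≤s z≤n , f h) , λ _ → g
      go (suc y) rewrite half-bit b (set s j) | +-suc a y =
        let f , g = set-spec s j (suc a) (trans (sym (+-suc a j)) eq) y in
        (λ h → let p , q = f h in s≤s p , q) , λ { (s≤s p) → g p }

  setᶠ : Fun 1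
  setᶠ = hidden setᵣ

  setᶠ-sound : ∀ s {y} → D (⟦ setᶠ ⟧ (s ∷ [])) y → y < s × Holds T (y ∷ s ∷ [])
  setᶠ-sound s {y} h = proj₁ (set-spec s s 0 refl y) (subst (λ u → D u y) (hidden-≡ setᵣ (s ∷ [])) h)

  setᶠ-complete : ∀ s {y} → y < s → Holds T (y ∷ s ∷ []) → D (⟦ setᶠ ⟧ (s ∷ [])) y
  setᶠ-complete s {y} y<s h =
    subst (λ u → D u y) (sym (hidden-≡ setᵣ (s ∷ []))) (proj₂ (set-spec s s 0 refl y) y<s h)

-- The enumeration of A

private
  enteredᵗ : Test 2
  enteredᵗ = sealed $ ∃<ᵗ (var 1F) (callᵗ memberᵗ (var 0F ∷ var 1F ∷ []))

A-index : ℕ → ℕ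
A-index s = ⟦ setᶠ enteredᵗ ⟧ (s ∷ [])

private
  entered : ∀ {x s} → D (A-index s) x → ∃[ q ] q < s × Win q × lft q ≡ x
  entered {x} {s} h = proj₂ (setᶠ-sound enteredᵗ s {x} h)

  enters : ∀ {q s} → q < s → Win q → D (A-index s) (lft q)
  enters {q} {s} q<s win = setᶠ-complete enteredᵗ s {lft q} (≤-<-trans (lft≤ q) q<s) (q , q<s , win , refl)

  A-increasing : ∀ s → D (A-index s) ⊆ D (A-index (suc s))
  A-increasing s {x} h = again (entered {x} {s} h)
    where
    again : ∃[ q ] q < s × Win q × lft q ≡ x → D (A-index (suc s)) x
    again (q , q<s , win , refl) = enters {q} (m<n⇒m<1+n q<s) win

  A-exhausting : (⋃[ s ∶ ℕ ] D (A-index s)) ≐ A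
  A-exhausting = to , from
    where
    to : ∀ {x} → ∃[ s ] D (A-index s) x → x ∈ A
    to {x} (s , h) = let q , _ , m = entered {x} {s} h in q , m
    from : ∀ {x} → x ∈ A → ∃[ s ] D (A-index s) x
    from (q , win , refl) = suc q , enters {q} ≤-refl win

A-enumeration : Enumeration A
A-enumeration = record
  { index      = A-index
  ; computable = ⇒computable (setᶠ enteredᵗ)
  ; increasing = A-increasing
  ; exhausting = A-exhausting }

-- The code `q` of a win bounds the stage `rgt q`, so a follower enters `A` only after it is done.
A-stage⇒ : ∀ {x s} → D (A-index s) x → x ∈ A × ∃[ r ] r < s × ∃[ v ] ∃[ s₀ ] S x r ≡ active 0 v s₀
A-stage⇒ {x} {s} h = go (entered {x} {s} h)
  where
  go : ∀ {x s} → ∃[ q ] q < s × Win q × lft q ≡ x →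
       x ∈ A × ∃[ r ] r < s × ∃[ v ] ∃[ s₀ ] S x r ≡ active 0 v s₀
  go (q , q<s , win@(d , _) , refl) = (q , win , refl) , rgt q , ≤-<-trans (rgt≤ q) q<s , done-active d

-- Bounded collection; by monotonicity a sum serves as the common bound.
collect : (P : ℕ → ℕ → Set) → (∀ {i M N} → M ≤ N → P i M → P i N) →
  ∀ k → (∀ {i} → i < k → ∃[ N ] P i N) → ∃[ N ] (∀ {i} → i < k → P i N)
collect P mono zero    h = 0 , λ ()
collect P mono (suc k) h = let N , f = collect P mono k (λ i<k → h (m<n⇒m<1+n i<k)) ; M , p = h ≤-refl in
  N + M , λ i<1+k → [ (λ i<k → mono (m≤m+n N M) (f i<k)) , (λ { refl → mono (m≤n+m M N) p }) ]′
    (m<1+n⇒m<n∨m≡n i<1+k)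

-- The set A is 3-tardy

-- s ∷ k ∷ x ∷ []
leftᵗ : Test 3
leftᵗ = sealed $ callᵗ reachedᵗ (sucᶠ (var 1F) ∷ var 2F ∷ var 0F ∷ [])

leaving : Code
leaving = search leftᵗ

-- The set subtracted in Vᵏ is the domain of this program, with `k` built in and a known overhead
-- over `leaving`.
leavingAt : ℕ → Code
leavingAt k = comp leaving (pair (constant k) (pair identity zero))

leavingAt⇓ : ∀ {k x y t} → ∅ ⊢ leaving ∙ ⌜ k ∷ x ∷ [] ⌝ ⇓ y ∣ t →
  ∅ ⊢ leavingAt k ∙ x ⇓ y ∣ suc (suc (suc (k + k) + 5) + t)
leavingAt⇓ {k} {x} d = comp (pair (constant⇓ k x) (pair (identity⇓ x) zero)) d

leavingAt⇓⁻ : ∀ {k x y t} → ∅ ⊢ leavingAt k ∙ x ⇓ y ∣ t → ∃[ s ] Reached (suc k) (S x s)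
leavingAt⇓⁻ {k} {x} (comp {y = z} d e) = search-sound leftᵗ (k ∷ x ∷ [])
  (subst (λ z → ∅ ⊢ leaving ∙ z ⇓ _ ∣ _) (deterministic d (pair (constant⇓ k x) (pair (identity⇓ x) zero))) e)

private
  leavingNo : ℕ
  leavingNo = number leaving

Caught-up : ℕ → ℕ → Set
Caught-up N v = ∀ {k} → k < suc v → ∀ {x} → x < suc v →
  Reached (suc k) (S x (suc v)) → Runs leavingNo (k ∙ x ∙ 0) 0 N

-- N ∷ v ∷ []
caught-upᵗ : Test 2
caught-upᵗ = sealed $ ∀<ᵗ (sucᶠ (var 1F)) (∀<ᵗ (sucᶠ (var 2F))
  (callᵗ reachedᵗ (sucᶠ (var 1F) ∷ var 0F ∷ sucᶠ (var 3F) ∷ [])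
    →ᵗ callᵗ runsᵗ (lit leavingNo ∷ (var 1F ∙ᶠ var 0F ∙ᶠ lit 0) ∷ lit 0 ∷ var 2F ∷ [])))

private
  code≡ : ∀ k x → ⌜ k ∷ x ∷ [] ⌝ ≡ k ∙ x ∙ 0
  code≡ k x = sym (trans (cong (k ∙_) (∙≡⟨⟩ x 0)) (∙≡⟨⟩ k ⟨ x , 0 ⟩))

  leavingNo⇓ : ∀ {k x y t} → ∅ ⊢ leaving ∙ ⌜ k ∷ x ∷ [] ⌝ ⇓ y ∣ t → ∅ ⊢ program leavingNo ∙ (k ∙ x ∙ 0) ⇓ y ∣ t
  leavingNo⇓ {k} {x} {y} {t} = subst₂ (λ c z → ∅ ⊢ c ∙ z ⇓ y ∣ t) (sym (program-number leaving)) (code≡ k x)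

  leavingNo⇓⁻ : ∀ {k x y t} → ∅ ⊢ program leavingNo ∙ (k ∙ x ∙ 0) ⇓ y ∣ t → ∅ ⊢ leaving ∙ ⌜ k ∷ x ∷ [] ⌝ ⇓ y ∣ t
  leavingNo⇓⁻ {k} {x} {y} {t} = subst₂ (λ c z → ∅ ⊢ c ∙ z ⇓ y ∣ t) (program-number leaving) (sym (code≡ k x))

  catches-up : ∀ v → ∃[ N ] Caught-up N v
  catches-up v = collect
    (λ k N → ∀ {x} → x < suc v → Reached (suc k) (S x (suc v)) → Runs leavingNo (k ∙ x ∙ 0) 0 N)
    (λ M≤N f x< r → runs-mono {leavingNo} M≤N (f x< r)) (suc v)
    λ {k} _ → collect (λ x N → Reached (suc k) (S x (suc v)) → Runs leavingNo (k ∙ x ∙ 0) 0 N)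
      (λ M≤N f r → runs-mono {leavingNo} M≤N (f r)) (suc v)
      λ {x} _ → one k x (holds? reachedᵗ (suc k ∷ x ∷ suc v ∷ []))
    where
    one : ∀ k x → Dec (Reached (suc k) (S x (suc v))) →
          ∃[ N ] (Reached (suc k) (S x (suc v)) → Runs leavingNo (k ∙ x ∙ 0) 0 N)
    one k x (no ¬r) = 0 , λ r → contradiction r ¬r
    one k x (yes r) = let y , t , d = search-halts leftᵗ (k ∷ x ∷ []) {suc v} r in
      t , λ _ → proj₁ (runs∅-complete (number-canonical leaving) (leavingNo⇓ {k} {x} d) ≤-refl)

  catches-upᵛ : ∀ v → ∃[ N ] Holds caught-upᵗ (N ∷ v)
  catches-upᵛ (v ∷ []) = catches-up v

-- The programs leavingAt k enumerate x with a delay bounded uniformly in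
-- k ≤ v. Hence the function p ∘ delay can be formed before its index k
-- is known, and the recursion theorem is not needed.
delayᵣ : Fun 1
delayᵣ = minimise caught-upᵗ catches-upᵛ +ᶠ (var 0F +ᶠ var 0F) +ᶠ lit 8

private
  delayᵣ-spec : ∀ {k x v s} → k ≤ v → x ≤ v → Reached (suc k) (S x (suc v)) → ⟦ delayᵣ ⟧ (v ∷ []) ≤ s →
    W[ number (leavingAt k) , s ] x
  delayᵣ-spec {k} {x} {v} {s} k≤v x≤v r T≤s =
    go (runs∅-sound (number-canonical leaving)
         (proj₁ (minimise-least caught-upᵗ catches-upᵛ (v ∷ [])) {k} (s≤s k≤v) {x} (s≤s x≤v) r))
    where
    N = ⟦ minimise caught-upᵗ catches-upᵛ ⟧ (v ∷ [])
    y = value leavingNo (k ∙ x ∙ 0) 0 N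
    v<T : ∀ N → v < N + (v + v) + 8
    v<T N = subst (v <_) (sym (+-suc (N + (v + v)) 7))
      (s≤s (≤-trans (m≤m+n v v) (≤-trans (m≤n+m (v + v) N) (m≤m+n (N + (v + v)) 7))))
    -- `leavingAt k` takes `2k + 8` steps more than `leaving`, and `k ≤ v`.
    time : ∀ {t N} → t ≤ N → suc (suc (suc (k + k) + 5) + t) ≤ N + (v + v) + 8
    time {t} {N} t≤N = subst (_≤ N + (v + v) + 8) (lemma k t) (+-monoˡ-≤ 8 (+-mono-≤ t≤N (+-mono-≤ k≤v k≤v)))
      where
      lemma : ∀ k t → t + (k + k) + 8 ≡ suc (suc (suc (k + k) + 5) + t)
      lemma = solve-∀
    go : ∃[ t ] t ≤ N × ∅ ⊢ program leavingNo ∙ (k ∙ x ∙ 0) ⇓ y ∣ t → W[ number (leavingAt k) , s ] x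
    go (t , t≤N , d) = ≤-trans (≤-trans (s≤s x≤v) (v<T N)) T≤s , y , _ , ≤-trans (time {t} {N} t≤N) T≤s ,
      subst (λ c → ∅ ⊢ c ∙ x ⇓ y ∣ suc (suc (suc (k + k) + 5) + t)) (sym (program-number (leavingAt k)))
        (leavingAt⇓ {k} (leavingNo⇓⁻ {k} {x} d))

opaque

  delay : ℕ → ℕ
  delay v = ⟦ delayᵣ ⟧ (v ∷ [])

  delay-≡ : ∀ v → ⟦ delayᵣ ⟧ (v ∷ []) ≡ delay v
  delay-≡ v = refl

delayᶠ : Fun 1
delayᶠ = _≗by_ delayᵣ {g = λ { (v ∷ []) → delay v }} λ { (v ∷ []) → delay-≡ v }

delay-spec : ∀ {k x v s} → k ≤ v → x ≤ v → Reached (suc k) (S x (suc v)) → delay v ≤ s →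
  W[ number (leavingAt k) , s ] x
delay-spec {k} {x} {v} {s} k≤v x≤v r T≤s =
  delayᵣ-spec {k} {x} {v} {s} k≤v x≤v r (subst (_≤ s) (sym (delay-≡ v)) T≤s)

-- If pⱼ diverges at `v`, then `Converged j x` fails forever for `x ≥ v`, and goodness is vacuous.
-- If pⱼ is total, every `x` is good.
good-bound : ExcludedMiddle 0ℓ → ∀ k → ∃[ M ] ∀ {x} → M ≤ x → ∀ {j} → j < k → Good {x} j
good-bound em k = let M , f = collect (λ j M → ∀ {x} → M ≤ x → Good {x} j) (λ M≤N f N≤x → f (≤-trans M≤N N≤x)) k
                        (λ {j} _ → one j) in M , λ M≤x j<k → f j<k M≤x
  where
  one : ∀ j → ∃[ M ] ∀ {x} → M ≤ x → Good {x} j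
  one j = decide (em {∃[ v ] ¬ (∃[ s ] Runs j v 0 s)})
    where
    decide : Dec (∃[ v ] ¬ (∃[ s ] Runs j v 0 s)) → ∃[ M ] ∀ {x} → M ≤ x → Good {x} j
    decide (yes (v , ¬h)) = v , λ v≤x c → ⊥-elim (¬h (_ , c (s≤s v≤x)))
    decide (no ¬e)        = 0 , λ _ {v} _ → total v em
      where
      total : ∀ v → Dec (∃[ s ] Runs j v 0 s) → ∃[ s ] Runs j v 0 s
      total v (yes h) = h
      total v (no ¬h) = ⊥-elim (¬e (v , ¬h))

-- Each owner has at most one follower in `A`, and there are only `k` owners to consider.
owner-bound : ExcludedMiddle 0ℓ → ∀ k → ∃[ M ] ∀ {x} → x ∈ A → owner x < k → x < M
owner-bound em k = let M , f = collect (λ n M → ∀ {x} → x ∈ A → owner x ≡ n → x < M)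
                         (λ M≤N f a eq → <-≤-trans (f a eq) M≤N) k (λ {n} _ → one n em)
                   in M , λ a n<k → f n<k a refl
  where
  one : ∀ n → Dec (∃[ x ] x ∈ A × owner x ≡ n) → ∃[ M ] ∀ {x} → x ∈ A → owner x ≡ n → x < M
  one n (no ¬e) = 0 , λ {x} a eq → ⊥-elim (¬e (x , a , eq))
  one n (yes (y , (q , win , lq≡y) , oy)) = suc y , λ { {x} (r , win′ , lr≡x) ox → s≤s (≤-reflexive
    (trans (sym lr≡x) (trans (win-unique win′ win
      (trans (cong owner lr≡x) (trans ox (trans (sym oy) (cong owner (sym lq≡y)))))) lq≡y))) }

private
  -- Here k is an index of p ∘ delay, and Vᵏ = (W i₁ - W i₂) ∪ W i₃. Below M,
  -- where Vᵏ may err, membership is read off the table w.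
  module ThreeTardy (em : ExcludedMiddle 0ℓ) (p : ℕ → ℕ) (p-mono : ∀ {s t} → s ≤ t → p s ≤ p t) (k : ℕ)
    (k-halts : ∀ v → ∃[ N ] Runs k v 0 N) (k-value : ∀ {v N} → Runs k v 0 N → value k v 0 N ≡ p (delay v))
    (M : ℕ) (good : ∀ {x} → M ≤ x → ∀ {j} → j < suc k → Good {x} j)
    (owned : ∀ {x} → M ≤ x → x ∈ A → k < owner x)
    (w : ℕ) (table : ∀ {x} → x < M → (D w x → x ∉ A) × (x ∉ A → D w x)) where

    converges : ∀ x → ∃[ c ] Converged k x c
    converges x = let N , f = collect (λ i N → Runs k i 0 N) (runs-mono {k}) (suc x) (λ {i} _ → k-halts i)
                  in N , λ {i} → f {i}

    -- c ∷ x ∷ []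
    enters-test : Test 2
    enters-test = sealed $ lit M ≤ᵗ var 1F ×ᵗ callᵗ convergedᵗ (lit k ∷ var 1F ∷ var 0F ∷ [])
      ×ᵗ ¬ᵗ callᵗ reachedᵗ (lit (suc k) ∷ var 1F ∷ var 0F ∷ [])

    -- The reasons for which `x` can be returned to Vᵏ for good: the table below `M`, its
    -- cancellation, or the victory of another follower of its owner.
    returns-test : Test 2
    returns-test = sealed $ (var 1F <ᵗ lit M ×ᵗ var 1F ∈Dᵗ lit w)
      ⊎ᵗ (lit M ≤ᵗ var 1F ×ᵗ (callᵗ cancelledᵗ (var 1F ∷ var 0F ∷ []) ⊎ᵗ callᵗ lostᵗ (var 1F ∷ var 0F ∷ [])))

    i₁ i₂ i₃ : ℕ
    i₁ = W-index enters-test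
    i₂ = number (leavingAt k)
    i₃ = W-index returns-test

    left⇒ : ∀ {x} → W i₂ x → ∃[ s ] Reached (suc k) (S x s)
    left⇒ {x} (y , t , d) =
      leavingAt⇓⁻ {k} {x} (subst (λ c → ∅ ⊢ c ∙ x ⇓ y ∣ t) (program-number (leavingAt k)) d)

    ⇒left : ∀ {x s} → Reached (suc k) (S x s) → W i₂ x
    ⇒left {x} {s} r = go (search-halts leftᵗ (k ∷ x ∷ []) {s} r)
      where
      go : ∃[ y ] ∅ ⊢ leaving ∙ ⌜ k ∷ x ∷ [] ⌝ ⇓ y → W i₂ x
      go (y , t , d) = y , suc (suc (suc (k + k) + 5) + t) ,
        subst (λ c → ∅ ⊢ c ∙ x ⇓ y ∣ suc (suc (suc (k + k) + 5) + t)) (sym (program-number (leavingAt k)))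
          (leavingAt⇓ {k} {x} d)

    returned∉A : ∀ {x} → W i₃ x → x ∉ A
    returned∉A {x} h = go (W-index-sound returns-test h)
      where
      go : ∃[ s ] Holds returns-test (s ∷ x ∷ []) → x ∉ A
      go (s , inj₁ (x<M , x∈w))    = proj₁ (table x<M) x∈w
      go (s , inj₂ (_ , inj₁ c))   = cancelled∉A c
      go (s , inj₂ (_ , inj₂ l))   = lost∉A {s = s} l

    stays∉A : ∀ {x} → ¬ W i₂ x → x ∉ A
    stays∉A {x} ¬left (q , (d , _) , refl) = ¬left (⇒left {s = rgt q} (weaken (S x (rgt q)) d))
      where
      weaken : ∀ σ → Reached 0 σ → Reached (suc k) σ
      weaken (active zero _ _) _ = z≤n

    -- From `M` on, an `x` that never leaves is in the first difference, as pₖ is total. One that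
    -- leaves is later cancelled or done; if it is done outside `A`, another follower has won.
    covers : ∀ {x} → x ∉ A → (W i₁ x × ¬ W i₂ x) ⊎ W i₃ x
    covers {x} x∉A = small? (x <? M)
      where
      returned : ∀ {s} → Holds returns-test (s ∷ x ∷ []) → W i₃ x
      returned {s} = W-index-complete returns-test {x} {s}
      finish : M ≤ x → ∀ {s₀} → ∃[ s ] (Killed {x} s₀ (S x s) ⊎ ∃[ v ] S x s ≡ active 0 v s₀) → W i₃ x
      finish M≤x (s , inj₁ (c , _))  = returned {s} (inj₂ (M≤x , inj₁ c))
      finish M≤x (s , inj₂ (_ , eq)) = let q , win , same = win-exists {x} {s} (active-done eq) in
        returned {suc q} (inj₂ (M≤x , inj₂ (q , ≤-refl , win , same , λ lq≡x → x∉A (q , win , lq≡x))))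
      reached : M ≤ x → ∀ {σ} s → S x s ≡ σ → Reached (suc k) σ → W i₃ x
      reached M≤x {active j v s₀} s eq j≤1+k =
        finish M≤x (resolves j (λ i<j → good M≤x (<-≤-trans i<j j≤1+k)) eq)
      left? : M ≤ x → Dec (W i₂ x) → (W i₁ x × ¬ W i₂ x) ⊎ W i₃ x
      left? M≤x (yes h) = let s , r = left⇒ h in inj₂ (reached M≤x s refl r)
      left? M≤x (no ¬h) = let c , conv = converges x in
        inj₁ (W-index-complete enters-test {x} {c} (M≤x , conv , λ r → ¬h (⇒left {s = c} r)) , ¬h)
      small? : Dec (x < M) → (W i₁ x × ¬ W i₂ x) ⊎ W i₃ x
      small? (yes x<M) = inj₂ (returned {0} (inj₁ (x<M , proj₂ (table x<M) x∉A)))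
      small? (no x≮M)  = left? (≮⇒≥ x≮M) em

    -- If `x` were in `A` at stage `p s`, it would have left Vᵏ at some `v` after joining it. This
    -- departure is not seen at `s`, so `s < delay v`; but `x` then waited for `p (delay v)`, which
    -- is at least `p s`.
    not-yet : ∀ {x s} → W i₁ x → ¬ W[ i₂ , s ] x → ¬ D (A-index (p s)) x
    not-yet {x} {s} h ¬left x∈Aₚₛ = go (W-index-sound enters-test h) (A-stage⇒ {x} {p s} x∈Aₚₛ)
      where
      go : ∃[ c ] Holds enters-test (c ∷ x ∷ []) →
           x ∈ A × ∃[ r ] r < p s × ∃[ v ] ∃[ s₀ ] S x r ≡ active 0 v s₀ → ⊥
      go (c , M≤x , conv , ¬r) (x∈A , r , r<ps , v′ , s₀ , eq) = leaves (passage k<n r eq z≤n)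
        where
        k<n = owned M≤x x∈A
        leaves : ∃[ v ] S x (suc v) ≡ active (suc k) v s₀ ×
          (Converged k x v → ∃[ t ] t ≤ v′ × Runs k v 0 t × value k v 0 t ≤ t) → ⊥
        leaves (v , since , released) = stuck (released (Converged-mono c≤v λ {i} → conv {i}))
          where
          open Invariant (invariant (suc v) since) using (s₀≤v; starts)
          x≤v : x ≤ v
          x≤v = ≤-trans (proj₁ (proj₂ starts)) s₀≤v
          has-left : Reached (suc k) (S x (suc v))
          has-left = subst (Reached (suc k)) (sym since) ≤-refl
          still : Killed {x} s₀ (S x c) ⊎ Alive {x} (suc k) s₀ (S x c) → ⊥
          still (inj₁ (eq′ , _))               = cancelled∉A eq′ x∈A
          still (inj₂ (j , _ , eq′ , j≤1+k)) = ¬r (subst (Reached (suc k)) (sym eq′) j≤1+k)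
          c≤v : c ≤ v
          c≤v = ≮⇒≥ λ v<c → still (later v<c since)
          s<T : s < delay v
          s<T = ≰⇒> λ T≤s → ¬left (delay-spec (≤-trans (<⇒≤ k<n) (≤-trans (lft≤ x) x≤v)) x≤v has-left T≤s)
          stuck : ∃[ t ] t ≤ v′ × Runs k v 0 t × value k v 0 t ≤ t → ⊥
          stuck (t , t≤v′ , runs , value≤t) = <-irrefl refl (begin-strict
            p s           ≤⟨ p-mono (<⇒≤ s<T) ⟩
            p (delay v)   ≡⟨ k-value runs ⟨
            value k v 0 t ≤⟨ value≤t ⟩
            t             ≤⟨ t≤v′ ⟩
            v′            <⟨ Invariant.v<s (invariant r eq) ⟩
            r             <⟨ r<ps ⟩
            p s           ∎)
            where open ≤-Reasoning

    es : Vec ℕ 3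
    es = i₁ ∷ i₂ ∷ i₃ ∷ []

    W-stage : ∀ {e s x} → W[ e , s ] x → W e x
    W-stage (_ , y , t , _ , d) = y , t , d

    correct-set : alternating W es ≐ ∁ A
    correct-set = to , from
      where
      to : ∀ {x} → alternating W es x → x ∉ A
      to (inj₁ (_ , ¬left)) = stays∉A ¬left
      to (inj₂ h)           = returned∉A h
      from : ∀ {x} → x ∉ A → alternating W es x
      from = covers

    avoids : ∀ x s → alternating (λ i → W[ i , s ]) es x → ¬ D (A-index (p s)) x
    avoids x s (inj₁ (h , ¬left)) = not-yet {x} {s} (W-stage {i₁} h) ¬left
    avoids x s (inj₂ h)           = λ x∈A → returned∉A (W-stage {i₃} h) (proj₁ (A-stage⇒ {x} {p s} x∈A))

    tardy-at : ∃[ e ] (X 3 e ≐ ∁ A) × (∀ x s → X[ 3 , e , s ] x → ¬ D (A-index (p s)) x)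
    tardy-at = let e , eq = indices-onto es in e ,
      subst (λ es → alternating W es ≐ ∁ A) (sym eq) correct-set ,
      subst (λ es → ∀ x s → alternating (λ i → W[ i , s ]) es x → ¬ D (A-index (p s)) x) (sym eq) avoids

A-tardy : ExcludedMiddle 0ℓ → Tardy 3 A
A-tardy em = A-enumeration , λ p computable monotone →
  let p̂ = call (computable⇒ computable) (delayᶠ ∷ [])
      c = unary (code p̂)
      halts : ∀ v → ∅ ⊢ program (number c) ∙ v ⇓ p (delay v)
      halts v = unary⇓ (correct p̂ (v ∷ []))
      -- The exceptions lie below `M₁ + M₂`: followers that are not good for some index up to `k`,
      -- and elements of `A` with owner at most `k`.
      M₁ , good = good-bound em (suc (number c))
      M₂ , owned = owner-bound em (suc (number c))
      w , table = finite-set em (∁ A) (M₁ + M₂)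
  in ThreeTardy.tardy-at em p monotone (number c)
    (λ v → let t , d = halts v in t , proj₁ (runs∅-complete (number-canonical c) d ≤-refl))
    (λ {v} r → let _ , _ , d = runs∅-sound (number-canonical c) r in deterministic d (proj₂ (halts v)))
    (M₁ + M₂) (λ M≤x → good (≤-trans (m≤m+n M₁ M₂) M≤x))
    (λ M≤x x∈A → ≰⇒> λ o≤k → <⇒≱ (owned x∈A (s≤s o≤k)) (≤-trans (m≤n+m M₂ M₁) M≤x))
    w table

-- No 2-tardy set computes A

make-ready : ∀ {x s b Φ w e e′} → enumerator x ≡ b → functional x ≡ Φ → first x ≡ e → second x ≡ e′ → x ≤ s →
  Runs b (rgt s) 0 s → value b (rgt s) 0 s ≡ w → Runs Φ x w s → value Φ x w s ≡ 0 →
  (∀ {y} → y < queries Φ x w s → D w y ⊎ (In² e s y × In² e′ s y)) → Ready x s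
make-ready refl refl refl refl x≤s r refl r′ eq settled = x≤s , r , r′ , eq , settled

private
  module NotBelow (em : ExcludedMiddle 0ℓ) {B : Pred ℕ 0ℓ} (E : Enumeration B) (b Φ : ℕ)
    (canonical-b : Canonical b) (canonical-Φ : Canonical Φ)
    (b⇓ : ∀ s → ∅ ⊢ program b ∙ s ⇓ Enumeration.index E s)
    (reduces : ∀ x → (x ∈ A → B ⊢ program Φ ∙ x ⇓ 1) × (x ∉ A → B ⊢ program Φ ∙ x ⇓ 0))
    (tardy : TardyVia 2 B E) where

    open Enumeration E

    indexᶠ : Fun 1
    indexᶠ = computable⇒ computable

    stage-mono : ∀ {s t y} → s ≤ t → D (index s) y → D (index t) y
    stage-mono {s} {t} {y} s≤t h = go (≤⇒≤′ s≤t)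
      where
      go : ∀ {t} → s ≤′ t → D (index t) y
      go (≤′-reflexive refl) = h
      go (≤′-step q)         = increasing _ {y} (go q)

    stage⊆B : ∀ {s y} → D (index s) y → y ∈ B
    stage⊆B {s} h = proj₁ exhausting (s , h)

    B⇒stage : ∀ {y} → y ∈ B → ∃[ s ] D (index s) y
    B⇒stage = proj₂ exhausting

    N : ℕ
    N = b ∙ Φ

    enumerator≡ : ∀ {x} → setup x ≡ N → enumerator x ≡ b
    enumerator≡ eq = trans (cong lft eq) (lft-∙ b Φ)

    functional≡ : ∀ {x} → setup x ≡ N → functional x ≡ Φ
    functional≡ eq = trans (cong rgt eq) (rgt-∙ b Φ)

    oracle-sound : ∀ {x s y} → setup x ≡ N → Ready x s → D (oracleAt x s) y → y ∈ B
    oracle-sound {x} {s} {y} eq (_ , r , _) = go (enumerator≡ {x} eq) r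
      where
      go : ∀ {c} → c ≡ b → Runs c (rgt s) 0 s → D (value c (rgt s) 0 s) y → y ∈ B
      go refl r h = let _ , _ , d = runs∅-sound canonical-b r in
        stage⊆B {rgt s} (subst (λ w → D w y) (deterministic d (proj₂ (b⇓ (rgt s)))) h)

    -- The oracle used at stage `s` is a stage of `B`, hence a subset of `B`; the stability
    -- hypothesis supplies the other half of the agreement below the use.
    predicts : ∀ {x s} → setup x ≡ N → Ready x s →
      (∀ {y} → y < useAt x s → ¬ D (oracleAt x s) y → y ∉ B) → B ⊢ program Φ ∙ x ⇓ 0
    predicts {x} {s} eq ready@(_ , _ , r , val , _) stable = go (functional≡ {x} eq) r val stable
      where
      w = oracleAt x s
      go : ∀ {c} → c ≡ Φ → Runs c x w s → value c x w s ≡ 0 →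
           (∀ {y} → y < queries c x w s → ¬ D w y → y ∉ B) → B ⊢ program Φ ∙ x ⇓ 0
      go refl r val stable = run-it (runs-sound (program Φ) (subst (λ c → Runs c x w s) (sym canonical-Φ) r))
        where
        run-it : ∃[ t ] t ≤ s × Σ[ d ∈ D w ⊢ program Φ ∙ x ⇓ value (encode (program Φ)) x w s ∣ t ]
                   queries (encode (program Φ)) x w s ≡ use d → B ⊢ program Φ ∙ x ⇓ 0
        run-it (t , _ , d , eq′) = t , subst (λ y → B ⊢ program Φ ∙ x ⇓ y ∣ t)
          (trans (cong (λ c → value c x w s) canonical-Φ) val)
          (use-principle d λ z<u → oracle-sound {x} {s} eq ready ,
            stable (subst (_ <_) (trans (sym eq′) (cong (λ c → queries c x w s) canonical-Φ)) z<u))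

    Caught : ℕ → ℕ → ℕ → Set
    Caught x s₀ s = ∃[ y ] y < useAt x s₀ × ¬ D (oracleAt x s₀) y × D (index s) y

    -- Only membership in `A` forces a change of `B`. A follower beaten by another one ends the wait
    -- through `Lost`.
    Over : ℕ → ℕ → ℕ → Set
    Over x s₀ s = Caught x s₀ s ⊎ Lost x s

    overᵗ : Test 3
    overᵗ = sealed $ ∃<ᵗ (call useAtᶠ (var 0F ∷ var 1F ∷ []))
        (¬ᵗ (var 0F ∈Dᵗ call oracleAtᶠ (var 1F ∷ var 2F ∷ [])) ×ᵗ var 0F ∈Dᵗ call indexᶠ (var 3F ∷ []))
      ⊎ᵗ callᵗ lostᵗ (var 0F ∷ var 2F ∷ [])

    Over-mono : ∀ {x s₀ s s′} → s ≤ s′ → Over x s₀ s → Over x s₀ s′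
    Over-mono s≤s′ (inj₁ (y , y<u , y∉w , h)) = inj₁ (y , y<u , y∉w , stage-mono {y = y} s≤s′ h)
    Over-mono s≤s′ (inj₂ (q , q<s , h))       = inj₂ (q , <-≤-trans q<s s≤s′ , h)

    -- Without a change below the use, the functional would yield both 0 and 1 at `x`.
    change : ∀ {x s₀} → x ∈ A → setup x ≡ N → Ready x s₀ → ∃[ s ] Over x s₀ s
    change {x} {s₀} x∈A eq ready = decide em
      where
      Enters : ℕ → Set
      Enters y = y < useAt x s₀ × ¬ D (oracleAt x s₀) y × y ∈ B
      decide : Dec (∃ Enters) → ∃[ s ] Over x s₀ s
      decide (yes (y , y<u , y∉w , y∈B)) = let s , h = B⇒stage y∈B in s , inj₁ (y , y<u , y∉w , h)
      decide (no ¬e) = case deterministic (proj₂ (proj₁ (reduces x) x∈A))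
        (proj₂ (predicts {x} {s₀} eq ready λ y<u y∉w y∈B → ¬e (_ , y<u , y∉w , y∈B))) of λ ()

    -- Common form of both waiting functions: `p s` is the least stage from `s` on at which every
    -- guarded follower `x ≤ s` started by stage `s` is over. By `ends` the wait is finite.
    module Delay (G : Test 2)
      (G-mono : ∀ {x s s′} → s ≤ s′ → Holds G (x ∷ s ∷ []) → Holds G (x ∷ s′ ∷ []))
      (ends : ∀ {x s₀ s} → Starts x s₀ → Holds G (x ∷ s ∷ []) → ∃[ s′ ] Over x s₀ s′) where

      Guard : ℕ → ℕ → Set
      Guard x s = Holds G (x ∷ s ∷ [])

      -- s′ ∷ s ∷ []
      waitᵗ : Test 2
      waitᵗ = sealed $ var 1F ≤ᵗ var 0F ×ᵗ ∀<ᵗ (sucᶠ (var 1F)) (∀<ᵗ (sucᶠ (var 2F))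
        (callᵗ startsᵗ (var 1F ∷ var 0F ∷ []) →ᵗ callᵗ G (var 1F ∷ var 3F ∷ []) →ᵗ
          callᵗ overᵗ (var 1F ∷ var 0F ∷ var 2F ∷ [])))

      waits : ∀ v → ∃[ s′ ] Holds waitᵗ (s′ ∷ v)
      waits (s ∷ []) = let s′ , f = outer in s + s′ , m≤m+n s s′ , λ {x} x< {s₀} s₀< st g →
          Over-mono (m≤n+m s′ s) (f {x} x< {s₀} s₀< st g)
        where
        End : ℕ → ℕ → ℕ → Set
        End x s₀ s′ = Starts x s₀ → Guard x s → Over x s₀ s′
        one : ∀ x s₀ → Dec (Starts x s₀) → Dec (Guard x s) → ∃[ s′ ] End x s₀ s′
        one x s₀ (yes st) (yes g) = let s′ , h = ends {x} {s₀} {s} st g in s′ , λ _ _ → h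
        one x s₀ (no ¬st) _       = 0 , λ st → contradiction st ¬st
        one x s₀ _        (no ¬g) = 0 , λ _ g → contradiction g ¬g
        inner : ∀ x → ∃[ s′ ] (∀ {s₀} → s₀ < suc s → End x s₀ s′)
        inner x = collect (End x) (λ p f st g → Over-mono p (f st g)) (suc s)
          (λ {s₀} _ → one x s₀ (holds? startsᵗ (x ∷ s₀ ∷ [])) (holds? G (x ∷ s ∷ [])))
        outer : ∃[ s′ ] (∀ {x} → x < suc s → ∀ {s₀} → s₀ < suc s → End x s₀ s′)
        outer = collect (λ x s′ → ∀ {s₀} → s₀ < suc s → End x s₀ s′)
          (λ p f s₀< st g → Over-mono p (f s₀< st g)) (suc s) (λ {x} _ → inner x)

      pᶠ : Fun 1
      pᶠ = minimise waitᵗ waits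

      p : ℕ → ℕ
      p s = ⟦ pᶠ ⟧ (s ∷ [])

      -- A stage that serves `t` also serves `s`, because the guard is monotone, and `p s` is the
      -- least that does.
      p-mono : ∀ {s t} → s ≤ t → p s ≤ p t
      p-mono {s} {t} s≤t = let (t≤pt , f) , _ = minimise-least waitᵗ waits (t ∷ []) in
        proj₂ (minimise-least waitᵗ waits (s ∷ [])) (≤-trans s≤t t≤pt , λ {x} x< {s₀} s₀< st g →
          f {x} (<-≤-trans x< (s≤s s≤t)) {s₀} (<-≤-trans s₀< (s≤s s≤t)) st (G-mono {x} s≤t g))

      over : ∀ {x s₀ s} → Starts x s₀ → s₀ ≤ s → Guard x s → Over x s₀ (p s)
      over {x} {s₀} {s} st@(_ , x≤s₀ , _) s₀≤s g =
        proj₂ (proj₁ (minimise-least waitᵗ waits (s ∷ []))) {x} (s≤s (≤-trans x≤s₀ s₀≤s)) {s₀} (s≤s s₀≤s) st g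

    -- The guard mentions only the setup, since `e` is obtained from the function being defined. The
    -- last departure at `v` shows at `suc v`; thus `p v` already waits for its consequences.
    firstᵗ : Test 2
    firstᵗ = sealed $ lftᶠ (lftᶠ (var 0F)) ≡ᵗ lit N ×ᵗ callᵗ reachedᵗ (lit 0 ∷ var 0F ∷ sucᶠ (var 1F) ∷ [])

    done-later : ∀ {x s s′} → s ≤ s′ → Done x s → Done x s′
    done-later {x} {s} s≤s′ d = let _ , _ , eq = done-active d in active-done (done-persists s≤s′ eq)

    first-mono : ∀ {x s s′} → s ≤ s′ → setup x ≡ N × Done x (suc s) → setup x ≡ N × Done x (suc s′)
    first-mono s≤s′ (eq , d) = eq , done-later (s≤s s≤s′) d

    first-ends : ∀ {x s₀ s} → Starts x s₀ → setup x ≡ N × Done x (suc s) → ∃[ s′ ] Over x s₀ s′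
    first-ends {x} {s₀} {s} (_ , ready) (eq , d) = go (win-exists {x} {suc s} d)
      where
      go : ∃[ q ] Win q × owner (lft q) ≡ owner x → ∃[ s′ ] Over x s₀ s′
      go (q , win , same) = decide (lft q ≟ x)
        where
        decide : Dec (lft q ≡ x) → ∃[ s′ ] Over x s₀ s′
        decide (yes lq≡x) = change (q , win , lq≡x) eq ready
        decide (no lq≢x)  = suc q , inj₂ (q , ≤-refl , win , same , lq≢x)

    module First (p : ℕ → ℕ)
      (over : ∀ {x s₀ s} → Starts x s₀ → s₀ ≤ s → setup x ≡ N × Done x (suc s) → Over x s₀ (p s))
      (e : ℕ) (w : Witness B stage p e) where

      o : ℕ
      o = N ∙ e

      setup≡ : ∀ {x} → owner x ≡ o → setup x ≡ N
      setup≡ eq = trans (cong lft eq) (lft-∙ N e)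

      first≡ : ∀ {x} → owner x ≡ o → first x ≡ e
      first≡ eq = trans (cong rgt eq) (rgt-∙ N e)

      -- If x enters A at stage v, then no y below the use has left the
      -- first set by then, so that p v contradicts the change in B.
      no-winner : ∀ {q} → Win q → ¬ owner (lft q) ≡ o
      no-winner {q} win eq = at (done-active (proj₁ win))
        where
        x = lft q
        at : ¬ (∃[ v ] ∃[ s₀ ] S x (rgt q) ≡ active 0 v s₀)
        at (v , s₀ , act) = go (over starts s₀≤v (setup≡ {x} eq , active-done since))
          where
          open Invariant (invariant (rgt q) act)
          go : ¬ Over x s₀ (p v)
          go (inj₂ lost) = lost∉A {s = p v} lost (q , win , refl)
          go (inj₁ (y , y<u , y∉w , h)) = settled (proj₂ (proj₂ (proj₂ (proj₂ (proj₂ starts)))) y<u)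
            where
            settled : ¬ (D (oracleAt x s₀) y ⊎ (In² (first x) s₀ y × In² (second x) s₀ y))
            settled (inj₁ y∈w)              = y∉w y∈w
            settled (inj₂ ((in-i , _) , _)) = Witness.tardy w {y} {v}
              (subst (λ e → In² e v y) (first≡ {x} eq)
                (In-mono {lft (first x)} s₀≤v in-i , λ in-j → unrefuted (y , y<u , y∉w , in-j))) h

      never-done : ∀ {x s} → owner x ≡ o → ¬ Done x s
      never-done {x} {s} eq d = let q , win , same = win-exists {x} {s} d in no-winner win (trans same eq)

      outside : ∀ {x} → owner x ≡ o → x ∉ A
      outside eq (q , win , refl) = no-winner win eq

      module _ (m : ℕ) (good : ∀ {x} → m ≤ x → ∀ {j} → j < o → Good {x} j) where

        -- The parameter `e′` is left open, as it is obtained from the function defined with this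
        -- guard.
        secondᵗ : Test 2
        secondᵗ = sealed $ lftᶠ (var 0F) ≡ᵗ lit o ×ᵗ lit m ≤ᵗ var 0F

        second-mono : ∀ {x s s′ : ℕ} → s ≤ s′ → owner x ≡ o × m ≤ x → owner x ≡ o × m ≤ x
        second-mono _ g = g

        -- By `resolves` the follower is done or cancelled, and `never-done` excludes the former.
        -- The `y` that refuted it has entered the subtracted set, hence lies in `B`.
        second-ends : ∀ {x s₀} → Starts x s₀ → owner x ≡ o × m ≤ x → ∃[ s′ ] Over x s₀ s′
        second-ends {x} {s₀} st (eq , m≤x) =
          go (resolves (owner x) (λ {j} j<o → good m≤x (subst (j <_) eq j<o)) (started st))
          where
          go : ∃[ s′ ] (Killed {x} s₀ (S x s′) ⊎ ∃[ v ] S x s′ ≡ active 0 v s₀) → ∃[ s′ ] Over x s₀ s′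
          go (s′ , inj₂ (_ , act)) = contradiction (active-done act) (never-done {x} {s′} eq)
          go (_ , inj₁ (_ , r , y , y<u , y∉w , in-j)) =
            let s′ , h = B⇒stage (Witness.departed w {y} {r}
                  (subst (λ e → In (lft (rgt e)) r y) (first≡ {x} eq) in-j))
            in s′ , inj₁ (y , y<u , y∉w , h)

        module Second (p₂ : ℕ → ℕ)
          (over₂ : ∀ {x s₀ s} → Starts x s₀ → s₀ ≤ s → owner x ≡ o × m ≤ x → Over x s₀ (p₂ s))
          (e′ : ℕ) (w₂ : Witness B stage p₂ e′) where

          x : ℕ
          x = o ∙ e′ ∙ m

          owner≡ : owner x ≡ o
          owner≡ = lft-∙ o (e′ ∙ m)

          second≡ : second x ≡ e′
          second≡ = trans (cong lft (rgt-∙ o (e′ ∙ m))) (lft-∙ e′ m)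

          m≤x : m ≤ x
          m≤x = ≤-trans (b≤a∙b e′ m) (b≤a∙b o (e′ ∙ m))

          -- As `x` is outside `A`, the functional yields 0 from `B`. A late stage of `B` agrees
          -- with `B` below the use, and eventually all other numbers below the use are in both
          -- 2-c.e. sets.
          becomes-ready : ∃[ s ] Ready x s
          becomes-ready = go (proj₂ (reduces x) (outside owner≡))
            where
            go : B ⊢ program Φ ∙ x ⇓ 0 → ∃[ s ] Ready x s
            go (t , d) = s , make-ready {e = e} {e′}
              (enumerator≡ {x} setup-x) (functional≡ {x} setup-x) (first≡ {x} owner≡) second≡
              (≤-trans (m≤m+n x _) i≤s)
              (subst (λ σ → Runs b σ 0 s) (sym rgt-s) b-runs)
              (trans (cong (λ σ → value b σ 0 s) rgt-s) b-value)
              Φ-runs Φ-value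
              (λ {y} y<q → settle y<q (D? (index σ) y))
              where
              setup-x = setup≡ {x} owner≡
              u = use d
              σ-spec : ∃[ σ ] (∀ {y} → y < u → y ∈ B → D (index σ) y)
              σ-spec = collect (λ y σ → y ∈ B → D (index σ) y)
                (λ {y} p h y∈B → stage-mono {y = y} p (h y∈B)) u λ {y} _ → one y em
                where
                one : ∀ y → Dec (y ∈ B) → ∃[ σ ] (y ∈ B → D (index σ) y)
                one y (yes y∈B) = let σ , h = B⇒stage y∈B in σ , λ _ → h
                one y (no y∉B)  = 0 , λ y∈B → contradiction y∈B y∉B
              σ = proj₁ σ-spec
              agree : AgreeBelow u B (D (index σ))
              agree {z} z<u = proj₂ σ-spec z<u , λ z∉B h → z∉B (stage⊆B {σ} {z} h)
              d′ : D (index σ) ⊢ program Φ ∙ x ⇓ 0 ∣ t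
              d′ = use-principle d agree
              tb = proj₁ (b⇓ σ)
              Settled : ℕ → ℕ → Set
              Settled y s = ¬ D (index σ) y → ∀ {r} → s ≤ r → In² e r y × In² e′ r y
              settled-spec : ∃[ c ] (∀ {y} → y < u → Settled y c)
              settled-spec = collect Settled (λ p f y∉w q → f y∉w (≤-trans p q)) u λ {y} y<u → one y y<u em
                where
                one : ∀ y → y < u → Dec (y ∈ B) → ∃[ c ] Settled y c
                one y y<u (yes y∈B) = 0 , λ y∉w → contradiction (proj₂ σ-spec y<u y∈B) y∉w
                one y y<u (no y∉B)  =
                  let c , f = Witness.arrives w y∉B ; c′ , f′ = Witness.arrives w₂ y∉B
                  in c + c′ , λ _ p → f (≤-trans (m≤m+n c c′) p) , f′ (≤-trans (m≤n+m c′ c) p)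
              c = proj₁ settled-spec
              i = x + (tb + (t + c))
              s = i ∙ σ
              i≤s : i ≤ s
              i≤s = a≤a∙b i σ
              rgt-s : rgt s ≡ σ
              rgt-s = rgt-∙ i σ
              tb≤s : tb ≤ s
              tb≤s = ≤-trans (≤-trans (m≤m+n tb _) (m≤n+m _ x)) i≤s
              t≤s : t ≤ s
              t≤s = ≤-trans (≤-trans (m≤m+n t c) (≤-trans (m≤n+m _ tb) (m≤n+m _ x))) i≤s
              c≤s : c ≤ s
              c≤s = ≤-trans (≤-trans (m≤n+m c t) (≤-trans (m≤n+m _ tb) (m≤n+m _ x))) i≤s
              b-runs : Runs b σ 0 s
              b-runs = proj₁ (runs∅-complete canonical-b (proj₂ (b⇓ σ)) tb≤s)
              b-value : value b σ 0 s ≡ index σ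
              b-value = proj₂ (runs∅-complete canonical-b (proj₂ (b⇓ σ)) tb≤s)
              Φ-runs : Runs Φ x (index σ) s
              Φ-runs = subst (λ c → Runs c x (index σ) s) canonical-Φ (runs-complete d′ t≤s)
              Φ-value : value Φ x (index σ) s ≡ 0
              Φ-value = subst (λ c → value c x (index σ) s ≡ 0) canonical-Φ (value-complete d′ t≤s)
              Φ-queries : queries Φ x (index σ) s ≡ u
              Φ-queries = trans
                (subst (λ c → queries c x (index σ) s ≡ use d′) canonical-Φ (queries-complete d′ t≤s))
                (use-use-principle d agree)
              settle : ∀ {y} → y < queries Φ x (index σ) s → Dec (D (index σ) y) →
                       D (index σ) y ⊎ (In² e s y × In² e′ s y)
              settle y<q (yes y∈w) = inj₁ y∈w
              settle y<q (no y∉w)  = inj₂ (proj₂ settled-spec (subst (_ <_) Φ-queries y<q) y∉w c≤s)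

          -- At its start `s₀` the follower has every relevant `y` in the second 2-c.e. set, yet
          -- some such `y` is in `B` by stage `p₂ s₀`, against tardiness.
          absurd : ⊥
          absurd = go (eventually-starts (proj₂ becomes-ready))
            where
            go : ¬ (∃[ s₀ ] Starts x s₀)
            go (s₀ , st) = end (over₂ st ≤-refl (owner≡ , m≤x))
              where
              end : ¬ Over x s₀ (p₂ s₀)
              end (inj₂ (q , _ , win , same , _)) = no-winner win (trans same owner≡)
              end (inj₁ (y , y<u , y∉w , h)) = settled (proj₂ (proj₂ (proj₂ (proj₂ (proj₂ st)))) y<u)
                where
                settled : ¬ (D (oracleAt x s₀) y ⊎ (In² (first x) s₀ y × In² (second x) s₀ y))
                settled (inj₁ y∈w)     = y∉w y∈w
                settled (inj₂ (_ , k)) = Witness.tardy w₂ {y} {s₀} (subst (λ e → In² e s₀ y) second≡ k) h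

    impossible : ⊥
    impossible = first-step (witness em E tardy D₁.pᶠ D₁.p-mono)
      where
      module D₁ = Delay firstᵗ first-mono first-ends
      first-step : ¬ ∃ (Witness B stage D₁.p)
      -- The owner `o` is fixed by `e`; this gives the bound `m`, and only then the second waiting
      -- function is formed.
      first-step (e , w) = second-step (good-bound em (F.o))
        where
        module F = First D₁.p D₁.over e w
        second-step : ¬ (∃[ m ] ∀ {x} → m ≤ x → ∀ {j} → j < F.o → Good {x} j)
        second-step (m , good) = last-step (witness em E tardy D₂.pᶠ D₂.p-mono)
          where
          module D₂ = Delay (F.secondᵗ m good) (F.second-mono m good) (F.second-ends m good)
          last-step : ¬ ∃ (Witness B stage D₂.p)
          last-step (e′ , w₂) = F.Second.absurd m good D₂.p D₂.over e′ w₂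

A≰ : ExcludedMiddle 0ℓ → ∀ {B} → Tardy 2 B → ¬ (A ≤T B)
A≰ em {B} (E , tardy) (φ , reduces) with b , b⇓ ← Enumeration.computable E =
  NotBelow.impossible em E (number (program b)) (number (program φ))
    (number-canonical (program b)) (number-canonical (program φ))
    (λ s → subst (λ c → ∅ ⊢ c ∙ s ⇓ Enumeration.index E s) (sym (program-number (program b))) (b⇓ s))
    (λ x → subst (λ c → (x ∈ A → B ⊢ c ∙ x ⇓ 1) × (x ∉ A → B ⊢ c ∙ x ⇓ 0))
      (sym (program-number (program φ))) (reduces x))
    tardy

theorem2p1 : ExcludedMiddle 0ℓ →
    ∃[ A ] CE A × Tardy 3 A ×
    (∀ (B : Pred ℕ 0ℓ) → CE B → Tardy 2 B → ¬ (A ≤T B))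
theorem2p1 em = A , A-ce , A-tardy em , λ B _ tardy → A≰ em tardy
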